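{- Let $D=(V,A)$ be a finite digraph and $Q=\{B\subseteq A: D[B]\text{ is totally cyclic}\}$ ordered by inclusion. Then $$\psi_{NL}^D(x)=\sum_{B\in Q}(-1)^{rk_Q(B)}x^{rk(A/B)}.$$
   Context: Digraphs may have loops, parallel and antiparallel arcs. $D[B]$ is the subdigraph formed by the arcs of $B$ and their ends; it is totally cyclic if each of its (weakly) connected components is strongly connected ($\emptyset\in Q$). $rk_Q(B)$ is the maximum length $r$ of a chain $\emptyset=B_0\subsetneq B_1\subsetneq\dots\subsetneq B_r=B$ in $Q$. $A/B$ is the digraph obtained from $D$ by contracting the arcs of $B$, and for a digraph $Y$, $rk(Y)$ is its number of vertices minus its number of (weakly) connected components. Definition of $\psi_{NL}^D$: let $\mathcal U$ be the set of arc sets $C\subseteq A$ that are unions of arc sets of finitely many directed cycles of $D$ (including $\emptyset$); let $\mathcal C=\{A/C: C\in\mathcal U\}$ ordered by $A/C'\le A/C$ iff $C\subseteq C'$; let $\mu(A,Y)$ be the Möbius function value on the interval from $Y$ up to $A$ in this poset (equivalently $\mu(A,A/C)=\mu_{\mathcal U}(\emptyset,C)$ for the Möbius function of $\mathcal U$ ordered by inclusion). Then $\psi_{NL}^D(x)=\sum_{Y\in\mathcal C}\mu(A,Y)x^{rk(Y)}$. -}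

module Defs where

open import Data.Bool using (Bool; true; false; _∧_; _∨_; not; if_then_else_)
open import Data.Nat using (ℕ; zero; suc; _∸_; _⊔_)
open import Data.Integer using (ℤ; +_; -_; _+_; _*_)
open import Data.Fin using (Fin; zero; suc; toℕ; _≟_)
open import Data.List using (List; []; _∷_; _++_; map; concatMap; upTo; allFin; foldr; filter; length)
open import Data.Vec using (Vec; []; _∷_; _∷ʳ_; toList; zipWith) renaming (map to vmap; head to vhead; tail to vtail)
open import Data.Fin.Subset using (Subset)
open import Relation.Nullary.Decidable using (⌊_⌋)

-- Finite digraphs: vertices Fin n, arcs Fin m, each arc has a tail and
-- a head.  Loops (tl e = hd e), parallel and antiparallel arcs allowed.

record Digraph : Set where
  field
    n  : ℕ
    m  : ℕ
    tl : Fin m → Fin n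
    hd : Fin m → Fin n
open Digraph public

anyFin : ∀ {k} → (Fin k → Bool) → Bool
anyFin {zero}  f = false
anyFin {suc k} f = f zero ∨ anyFin (λ i → f (suc i))

allFin? : ∀ {k} → (Fin k → Bool) → Bool
allFin? f = not (anyFin (λ i → not (f i)))

countFin : ∀ {k} → (Fin k → Bool) → ℕ
countFin {zero}  f = 0
countFin {suc k} f = (if f zero then 1 else 0) Data.Nat.+ countFin (λ i → f (suc i))

anyL : ∀ {X : Set} → (X → Bool) → List X → Bool
anyL p []       = false
anyL p (x ∷ xs) = p x ∨ anyL p xs

_==_ : ∀ {k} → Fin k → Fin k → Bool
i == j = ⌊ i ≟ j ⌋

_<ᶠ_ : ∀ {k} → Fin k → Fin k → Bool
i <ᶠ j = ⌊ toℕ i Data.Nat.<? toℕ j ⌋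

sumL : List ℤ → ℤ
sumL = foldr _+_ (+ 0)

elem : ∀ {m} → Fin m → Subset m → Bool
elem i S = Data.Vec.lookup S i

allSubsets : ∀ m → List (Subset m)
allSubsets zero    = [] ∷ []
allSubsets (suc m) = map (false ∷_) (allSubsets m) ++ map (true ∷_) (allSubsets m)

emptyS : ∀ {m} → Subset m
emptyS {m} = Data.Vec.replicate m false

unionS : ∀ {m} → Subset m → Subset m → Subset m
unionS = zipWith _∨_

isEmptyS : ∀ {m} → Subset m → Bool
isEmptyS {m} S = allFin? (λ i → not (elem i S))

eqS : ∀ {m} → Subset m → Subset m → Bool
eqS {m} S T = allFin? (λ i → (elem i S ∧ elem i T) ∨ (not (elem i S) ∧ not (elem i T)))

subS : ∀ {m} → Subset m → Subset m → Bool
subS {m} S T = allFin? (λ i → not (elem i S) ∨ elem i T)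

ssubS : ∀ {m} → Subset m → Subset m → Bool
ssubS S T = subS S T ∧ not (eqS S T)

-- Transitive closure of a Boolean relation on Fin k
-- (iterated squaring k times; paths have length < k ≤ 2^k).

Rel : ℕ → Set
Rel k = Fin k → Fin k → Bool

square : ∀ {k} → Rel k → Rel k
square R u v = R u v ∨ anyFin (λ w → R u w ∧ R w v)

iterate : ∀ {k} → ℕ → Rel k → Rel k
iterate zero    R = R
iterate (suc i) R = iterate i (square R)

closure : ∀ {k} → Rel k → Rel k
closure {k} R = iterate k R

-- "Partial" digraphs: a vertex set and an arc set given as predicates on
-- Fin n / Fin m, with tail/head maps.  Used for the contractions A/C.

record PDigraph : Set where
  field
    pn  : ℕ
    pm  : ℕ
    pV  : Fin pn → Bool
    pA  : Fin pm → Bool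
    ptl : Fin pm → Fin pn
    phd : Fin pm → Fin pn
open PDigraph public

weakConnP : (Y : PDigraph) → Rel (pn Y)
weakConnP Y = closure base
  where
  base : Rel (pn Y)
  base u v = (u == v) ∨ anyFin (λ e → pA Y e ∧
               (((ptl Y e == u) ∧ (phd Y e == v)) ∨ ((ptl Y e == v) ∧ (phd Y e == u))))

nVertP : PDigraph → ℕ
nVertP Y = countFin (pV Y)

-- number of weakly connected components of Y: count the vertices that are
-- the least (present) vertex in their component
nCompP : PDigraph → ℕ
nCompP Y = countFin (λ v → pV Y v ∧
             not (anyFin (λ u → pV Y u ∧ (u <ᶠ v) ∧ weakConnP Y u v)))

rkP : PDigraph → ℕ
rkP Y = nVertP Y ∸ nCompP Y

weakConn : (D : Digraph) → Subset (m D) → Rel (n D)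
weakConn D B = closure base
  where
  base : Rel (n D)
  base u v = (u == v) ∨ anyFin (λ e → elem e B ∧
               (((tl D e == u) ∧ (hd D e == v)) ∨ ((tl D e == v) ∧ (hd D e == u))))

reach : (D : Digraph) → Subset (m D) → Rel (n D)
reach D B = closure base
  where
  base : Rel (n D)
  base u v = (u == v) ∨ anyFin (λ e → elem e B ∧ (tl D e == u) ∧ (hd D e == v))

-- Contraction A/C: the vertices of A/C are the classes of the relation
-- "joined by arcs of C", represented by their least vertex; the arcs of
-- A/C are the arcs not in C, with ends replaced by the class representatives.

isRep : (D : Digraph) → Subset (m D) → Fin (n D) → Bool
isRep D C v = not (anyFin (λ u → (u <ᶠ v) ∧ weakConn D C u v))

rep : (D : Digraph) → Subset (m D) → Fin (n D) → Fin (n D)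
rep D C v = go (Data.List.reverse (allFin (n D)))
  where
  go : List (Fin (n D)) → Fin (n D)
  go []       = v
  go (u ∷ us) = if weakConn D C u v then (if (u <ᶠ go us) then u else go us) else go us

contract : (D : Digraph) → Subset (m D) → PDigraph
contract D C = record
  { pn = n D ; pm = m D
  ; pV = isRep D C
  ; pA = λ e → not (elem e C)
  ; ptl = λ e → rep D C (tl D e)
  ; phd = λ e → rep D C (hd D e) }

rkContr : (D : Digraph) → Subset (m D) → ℕ
rkContr D C = rkP (contract D C)

-- Directed cycles: a cyclic sequence of arcs e₀ … e_{k-1} (k ≥ 1) with
-- hd eᵢ = tl e_{i+1 mod k} and pairwise distinct vertices tl eᵢ.

distinct : ∀ {k} → List (Fin k) → Bool
distinct []       = true
distinct (x ∷ xs) = not (anyL (x ==_) xs) ∧ distinct xs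

allVecs : ∀ {X : Set} → List X → (k : ℕ) → List (Vec X k)
allVecs xs zero    = [] ∷ []
allVecs xs (suc k) = concatMap (λ x → map (x ∷_) (allVecs xs k)) xs

andL : List Bool → Bool
andL = foldr _∧_ true

isDirCycle : (D : Digraph) → ∀ {j} → Vec (Fin (m D)) (suc j) → Bool
isDirCycle D es =
  andL (toList (zipWith (λ e e' → hd D e == tl D e') es (vtail es ∷ʳ vhead es)))
  ∧ distinct (toList (vmap (tl D) es))

arcSetOf : ∀ {m k} → Vec (Fin m) k → Subset m
arcSetOf {m} es = Data.Vec.tabulate (λ i → anyL (i ==_) (toList es))

cycleArcSets : (D : Digraph) → List (Subset (m D))
cycleArcSets D = concatMap lenCycles (upTo (m D))
  where
  lenCycles : ℕ → List (Subset (m D))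
  lenCycles j = map arcSetOf (filter (λ es → Data.Bool._≟_ (isDirCycle D es) true)
                                     (allVecs (allFin (m D)) (suc j)))

sublists : ∀ {X : Set} → List X → List (List X)
sublists []       = [] ∷ []
sublists (x ∷ xs) = sublists xs ++ map (x ∷_) (sublists xs)

unionAll : ∀ {m} → List (Subset m) → Subset m
unionAll = foldr unionS emptyS

-- C ∈ 𝒰 : C is the union of (the arc sets of) finitely many directed
-- cycles of D (the empty union gives ∅).  Any finite family of cycle arc
-- sets has the same union as a subfamily of the list of all of them.
inU : (D : Digraph) → Subset (m D) → Bool
inU D C = anyL (λ F → eqS (unionAll F) C) (sublists (cycleArcSets D))

-- Möbius function μ_𝒰(∅, C) of 𝒰 ordered by inclusion:
--   μ(∅,∅) = 1,   μ(∅,C) = − Σ_{C' ∈ 𝒰, C' ⊊ C} μ(∅,C')   for C ≠ ∅.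
-- Fuel: strictly decreasing chains have length ≤ m, so fuel m+1 suffices.

muF : (D : Digraph) → ℕ → Subset (m D) → ℤ
muF D zero    C = + 0
muF D (suc f) C =
  if isEmptyS C then + 1
  else - sumL (map (muF D f)
                 (filter (λ C' → Data.Bool._≟_ (inU D C' ∧ ssubS C' C) true)
                         (allSubsets (m D))))

muU : (D : Digraph) → Subset (m D) → ℤ
muU D C = muF D (suc (m D)) C

-- ψ_NL^D as a coefficient sequence: coefficient of x^k is
--   Σ_{C ∈ 𝒰, rk(A/C) = k} μ(A, A/C)
psiNLCoeff : (D : Digraph) → ℕ → ℤ
psiNLCoeff D k =
  sumL (map (muU D)
    (filter (λ C → Data.Bool._≟_ (inU D C ∧ ⌊ rkContr D C Data.Nat.≟ k ⌋) true)
            (allSubsets (m D))))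

-- Q = { B ⊆ A : D[B] totally cyclic }.
-- D[B] has the arcs of B and their ends; it is totally cyclic iff every
-- weakly connected component is strongly connected, i.e. any two vertices
-- of D[B] joined by an undirected B-walk are joined by a directed B-path
-- (both ways, by symmetry of the quantifier).

inVB : (D : Digraph) → Subset (m D) → Fin (n D) → Bool
inVB D B v = anyFin (λ e → elem e B ∧ ((tl D e == v) ∨ (hd D e == v)))

inQ : (D : Digraph) → Subset (m D) → Bool
inQ D B = allFin? (λ u → allFin? (λ v →
            not (inVB D B u ∧ inVB D B v ∧ weakConn D B u v) ∨ reach D B u v))

chainQ : (D : Digraph) → ℕ → Subset (m D) → Bool
chainQ D zero    B = isEmptyS B
chainQ D (suc r) B = inQ D B ∧
  anyL (λ B' → inQ D B' ∧ ssubS B' B ∧ chainQ D r B') (allSubsets (m D))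

-- rk_Q(B) = maximal r with such a chain (chains have length ≤ m)
rkQ : (D : Digraph) → Subset (m D) → ℕ
rkQ D B = foldr (λ r acc → if chainQ D r B then r ⊔ acc else acc) 0 (upTo (suc (m D)))

signPow : ℕ → ℤ
signPow zero    = + 1
signPow (suc r) = - signPow r

rhsCoeff : (D : Digraph) → ℕ → ℤ
rhsCoeff D k =
  sumL (map (λ B → signPow (rkQ D B))
    (filter (λ B → Data.Bool._≟_ (inQ D B ∧ ⌊ rkContr D B Data.Nat.≟ k ⌋) true)
            (allSubsets (m D))))

{-# OPTIONS --safe #-}

-- B is totally cyclic iff every arc of B has a return path in B, iff B is a union of
-- directed cycles; so 𝒰 = Q and the claim is μ(∅,B) = (-1)^rk(B) on Q.  (Q is the face
-- lattice of the cone of nonnegative circulations, and rk(B) is the cyclomatic number.)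
-- This follows by Möbius recursion from  χ(A) = Σ_{B ⊆ A, B ∈ Q} (-1)^rk(B) = 0  whenever A
-- contains a directed cycle.  For an arc e that is not a loop, with reversal ē, cutting the
-- faces of A/e by the sign of the flow through e gives
--   χ(A ∪ e) + χ(A ∪ ē) = χ(A) + χ(A/e),
-- and the indicator of "acyclic" satisfies the same identity.  By induction on the number of
-- arcs the two therefore agree for A ∪ e iff they agree for A ∪ ē, so arcs may be turned
-- until all ascend with respect to a vertex numbering; then A is acyclic and χ(A) = 1.
-- The same contraction shows that every nonempty B ∈ Q contains some B′ ∈ Q with
-- cyclomatic number one less, so rk_Q is the cyclomatic number.

module Submission where

open import Defs
open import Algebra.Bundles using (AbelianGroup)
import Algebra.Properties.CommutativeSemigroup as CommutativeSemigroup
import Algebra.Properties.Group as Group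
open import Data.Bool using (Bool; true; false; if_then_else_; _∧_; _∨_; not; f≤t; b≤b)
import Data.Bool as Bool
import Data.Bool.Properties as Boolₚ
open import Data.Nat using (ℕ; zero; suc; _≤_; _<_; s≤s; z≤n; ⌈_/2⌉; _⊔_)
import Data.Nat as ℕ
import Data.Nat.Properties as ℕₚ
open import Data.Integer using (ℤ; +_; -_; _+_)
import Data.Integer.Properties as ℤₚ
open import Data.Fin using (Fin; zero; suc; toℕ)
import Data.Fin as Fin
open import Data.Fin.Properties using (toℕ-injective; injective⇒≤)
open import Data.Fin.Subset using (Subset)
open import Data.Vec using (Vec; []; _∷_; toList; fromList; _∷ʳ_; zipWith)
import Data.Vec as Vec
open import Data.Vec.Properties using (lookup∘tabulate; lookup-replicate; lookup-zipWith; toList∘fromList; toList-map)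
open import Data.Vec.Relation.Binary.Pointwise.Inductive using (Pointwise; []; _∷_)
open import Data.List using (List; []; _∷_; _++_; length; map; filter; foldr; upTo; allFin)
import Data.List as List
open import Data.List.Properties using (++-identityʳ; map-++; map-∘; map-cong; length-map)
open import Data.List.Membership.Propositional using (_∈_; lose)
open import Data.List.Membership.Propositional.Properties using (∈-map⁺; ∈-map⁻; ∈-++⁺ˡ; ∈-++⁺ʳ; ∈-++⁻; ∈-concatMap⁺; ∈-concatMap⁻; ∈-filter⁺; ∈-filter⁻; ∈-upTo⁺; ∈-allFin; ∈-lookup)
open import Data.List.Membership.DecPropositional using (_∈?_)
open import Data.List.Relation.Unary.Any as Any using (here; there)
open import Data.List.Relation.Unary.All as All using (All; []; _∷_)
open import Data.List.Relation.Unary.All.Properties using (¬Any⇒All¬)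
open import Data.List.Relation.Binary.Permutation.Propositional using (_↭_; ↭-sym; prep; swap)
import Data.List.Relation.Binary.Permutation.Propositional as ↭
open import Data.List.Relation.Binary.Permutation.Propositional.Properties using (∈-resp-↭; shift; ↭-length)
open import Data.List.Relation.Unary.AllPairs using ([]; _∷_)
open import Data.List.Relation.Unary.Unique.Propositional using (Unique)
import Data.List.Relation.Unary.Unique.Propositional.Properties as Unique
open import Data.Product using (_×_; _,_; proj₁; proj₂; ∃)
open import Data.Sum using (_⊎_; inj₁; inj₂)
open import Data.Empty using (⊥-elim)
open import Function using (_∘_; id; case_of_)
open import Relation.Nullary using (¬_; Dec; yes; no; does)
open import Relation.Nullary.Decidable using (⌊_⌋; map′; _⊎-dec_; _×-dec_; ¬?; dec-true; dec-false)
open import Relation.Binary.Definitions using (Tri; tri<; tri≈; tri>)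
open import Relation.Binary.PropositionalEquality using (_≡_; _≢_; refl; sym; trans; cong; cong₂; subst; module ≡-Reasoning)

+-interchange : ∀ a b c d → (a + b) + (c + d) ≡ (a + c) + (b + d)
+-interchange = CommutativeSemigroup.interchange ℤₚ.+-commutativeSemigroup

-- Contraction.  A map f : V → ℕ stands for the digraph in which vertices with equal
-- f-value are identified; the arcs keep their original ends.

module Contraction {V : Set} where

  Arc : Set
  Arc = V × V

  private variable
    f g : V → ℕ
    S T A : List Arc
    u v x y z : V

  -- Merging two vertex classes

  infix 4 _⊑_

  -- Inclusion of kernels. A contraction is determined by the kernel of its labelling; the order of
  -- the labels matters only once arcs are compared with it in `Ascending`.
  _⊑_ : (V → ℕ) → (V → ℕ) → Set
  f ⊑ g = ∀ {x y} → f x ≡ f y → g x ≡ g y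

  abstract
    merge : (V → ℕ) → V → V → V → ℕ
    merge f u v x = if does (f x ℕ.≟ f u) then f v else f x

    merge-at : ∀ f u v → f x ≡ f u → merge f u v x ≡ f v
    merge-at {x} f u v p = cong (λ b → if b then f v else f x) (dec-true (f x ℕ.≟ f u) p)

    merge-off : ∀ f u v → f x ≢ f u → merge f u v x ≡ f x
    merge-off {x} f u v p = cong (λ b → if b then f v else f x) (dec-false (f x ℕ.≟ f u) p)

    merge-⊒ : f ⊑ merge f u v
    merge-⊒ {f} {u} {v} {x} {y} eq = cong (λ k → if does (k ℕ.≟ f u) then f v else k) eq

  merge-ends : ∀ f u v → merge f u v u ≡ merge f u v v
  merge-ends f u v with f v ℕ.≟ f u
  ... | yes p = merge-⊒ {f} {u} {v} (sym p)
  ... | no ¬p = trans (merge-at f u v refl) (sym (merge-off f u v ¬p))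

  AtEnd : (V → ℕ) → V → V → V → Set
  AtEnd f u v x = f x ≡ f u ⊎ f x ≡ f v

  -- The only new identifications are between the classes of `u` and `v`. Every later analysis of an
  -- equality of merged labels goes through this case distinction.
  merge-≡ : ∀ f u v {x y} → merge f u v x ≡ merge f u v y → f x ≡ f y ⊎ (AtEnd f u v x × AtEnd f u v y)
  merge-≡ f u v {x} {y} eq with f x ℕ.≟ f u | f y ℕ.≟ f u
  ... | yes p | yes q = inj₁ (trans p (sym q))
  ... | yes p | no ¬q = inj₂ (inj₁ p , inj₂ (trans (sym (merge-off f u v ¬q)) (trans (sym eq) (merge-at f u v p))))
  ... | no ¬p | yes q = inj₂ (inj₂ (trans (sym (merge-off f u v ¬p)) (trans eq (merge-at f u v q))) , inj₁ q)
  ... | no ¬p | no ¬q = inj₁ (trans (sym (merge-off f u v ¬p)) (trans eq (merge-off f u v ¬q)))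

  -- Universal property of the contraction. Monotonicity, symmetry and commutation of merges follow
  -- from it without looking at labels.
  merge-least : f ⊑ g → g u ≡ g v → merge f u v ⊑ g
  merge-least {f} {g} {u} {v} fg guv {x} {y} eq with merge-≡ f u v eq
  ... | inj₁ p = fg p
  ... | inj₂ (p , q) = trans (toU p) (sym (toU q))
    where
    toU : ∀ {z} → AtEnd f u v z → g z ≡ g u
    toU (inj₁ r) = fg r
    toU (inj₂ r) = trans (fg r) (sym guv)

  merge-mono : f ⊑ g → merge f u v ⊑ merge g u v
  merge-mono {f} {g} {u} {v} fg = merge-least (λ p → merge-⊒ {g} {u} {v} (fg p)) (merge-ends g u v)

  merge-sym : ∀ f u v → merge f u v ⊑ merge f v u
  merge-sym f u v = merge-least (merge-⊒ {f} {v} {u}) (sym (merge-ends f v u))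

  merge-comm : ∀ f u v x y → merge (merge f u v) x y ⊑ merge (merge f x y) u v
  merge-comm f u v x y =
    merge-least {g = h}
      (merge-least {g = h} (λ p → merge-⊒ {merge f x y} {u} {v} (merge-⊒ {f} {x} {y} p)) (merge-ends _ u v))
      (merge-⊒ {merge f x y} {u} {v} (merge-ends f x y))
    where h = merge (merge f x y) u v

  -- Cyclomatic number

  abstract
    loopCount : (V → ℕ) → V → V → ℕ
    loopCount f u v = if does (f u ℕ.≟ f v) then 1 else 0

    loopCount-loop : f u ≡ f v → loopCount f u v ≡ 1
    loopCount-loop {f} {u} {v} p = cong (λ b → if b then 1 else 0) (dec-true (f u ℕ.≟ f v) p)

    loopCount-nonloop : f u ≢ f v → loopCount f u v ≡ 0
    loopCount-nonloop {f} {u} {v} p = cong (λ b → if b then 1 else 0) (dec-false (f u ℕ.≟ f v) p)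

  -- The cyclomatic number, computed greedily: the arcs that are not loops when their turn comes
  -- form a spanning forest, and the remaining arcs are counted.
  nullity : (V → ℕ) → List Arc → ℕ
  nullity f [] = 0
  nullity f ((u , v) ∷ S) = loopCount f u v ℕ.+ nullity (merge f u v) S

  loopCount-⇔ : (f u ≡ f v → g x ≡ g y) → (g x ≡ g y → f u ≡ f v) → loopCount f u v ≡ loopCount g x y
  loopCount-⇔ {f} {u} {v} {g} {x} {y} to from with f u ℕ.≟ f v
  ... | yes p = trans (loopCount-loop {f} p) (sym (loopCount-loop {g} (to p)))
  ... | no ¬p = trans (loopCount-nonloop {f} ¬p) (sym (loopCount-nonloop {g} (λ q → ¬p (from q))))

  nullity-kernel : f ⊑ g → g ⊑ f → ∀ S → nullity f S ≡ nullity g S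
  nullity-kernel fg gf [] = refl
  nullity-kernel {f} {g} fg gf ((u , v) ∷ S) =
    cong₂ ℕ._+_ (loopCount-⇔ {f} {g = g} fg gf) (nullity-kernel (merge-mono fg) (merge-mono gf) S)

  nullity-loop : f u ≡ f v → ∀ S → nullity f ((u , v) ∷ S) ≡ suc (nullity f S)
  nullity-loop {f} {u} {v} p S =
    cong₂ ℕ._+_ (loopCount-loop {f} p) (nullity-kernel (merge-least {g = f} (λ q → q) p) (merge-⊒ {f} {u} {v}) S)

  nullity-nonloop : f u ≢ f v → ∀ S → nullity f ((u , v) ∷ S) ≡ nullity (merge f u v) S
  nullity-nonloop {f} {u} {v} p S = cong (ℕ._+ nullity (merge f u v) S) (loopCount-nonloop {f} p)

  -- Exchange property of the graphic matroid: if contracting `u`, `v` joins `x` to `y`, then one of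
  -- `x`, `y` lies in the class of `u` and the other in that of `v`.
  merge-exchange : ∀ f u v x y → f x ≢ f y → merge f u v x ≡ merge f u v y → merge f x y u ≡ merge f x y v
  merge-exchange f u v x y ¬p q with merge-≡ f u v q
  ... | inj₁ r = ⊥-elim (¬p r)
  ... | inj₂ (inj₁ r , inj₁ s) = ⊥-elim (¬p (trans r (sym s)))
  ... | inj₂ (inj₂ r , inj₂ s) = ⊥-elim (¬p (trans r (sym s)))
  ... | inj₂ (inj₁ r , inj₂ s) =
    trans (merge-⊒ {f} {x} {y} (sym r)) (trans (merge-ends f x y) (merge-⊒ {f} {x} {y} s))
  ... | inj₂ (inj₂ r , inj₁ s) =
    trans (merge-⊒ {f} {x} {y} (sym s)) (trans (sym (merge-ends f x y)) (merge-⊒ {f} {x} {y} r))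

  loopCount-swap : ∀ f u v x y →
    loopCount f u v ℕ.+ loopCount (merge f u v) x y ≡ loopCount f x y ℕ.+ loopCount (merge f x y) u v
  loopCount-swap f u v x y = go (f u ℕ.≟ f v) (f x ℕ.≟ f y)
    where
    L = loopCount
    go : Dec (f u ≡ f v) → Dec (f x ≡ f y) →
         L f u v ℕ.+ L (merge f u v) x y ≡ L f x y ℕ.+ L (merge f x y) u v
    go (yes p) (yes q) = cong₂ ℕ._+_
      (trans (loopCount-loop {f} p) (sym (loopCount-loop {f} q)))
      (trans (loopCount-loop {merge f u v} (merge-⊒ {f} {u} {v} q))
             (sym (loopCount-loop {merge f x y} (merge-⊒ {f} {x} {y} p))))
    go (yes p) (no ¬q) =
      trans (cong₂ ℕ._+_ (loopCount-loop {f} p)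
               (loopCount-nonloop {merge f u v} (λ r → ¬q (merge-least {g = f} (λ s → s) p r))))
       (sym (cong₂ ℕ._+_ (loopCount-nonloop {f} ¬q) (loopCount-loop {merge f x y} (merge-⊒ {f} {x} {y} p))))
    go (no ¬p) (yes q) =
      trans (cong₂ ℕ._+_ (loopCount-nonloop {f} ¬p) (loopCount-loop {merge f u v} (merge-⊒ {f} {u} {v} q)))
       (sym (cong₂ ℕ._+_ (loopCount-loop {f} q)
               (loopCount-nonloop {merge f x y} (λ r → ¬p (merge-least {g = f} (λ s → s) q r)))))
    -- By exchange, either each arc becomes a loop once the other is contracted, or neither does.
    go (no ¬p) (no ¬q) = cong₂ ℕ._+_
      (trans (loopCount-nonloop {f} ¬p) (sym (loopCount-nonloop {f} ¬q)))
      (loopCount-⇔ {merge f u v} {g = merge f x y} (merge-exchange f u v x y ¬q) (merge-exchange f x y u v ¬p))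

  nullity-swap : ∀ f a b S → nullity f (a ∷ b ∷ S) ≡ nullity f (b ∷ a ∷ S)
  nullity-swap f (u , v) (x , y) S = begin
    loopCount f u v ℕ.+ (loopCount (merge f u v) x y ℕ.+ nullity (merge (merge f u v) x y) S)
      ≡⟨ ℕₚ.+-assoc (loopCount f u v) _ _ ⟨
    loopCount f u v ℕ.+ loopCount (merge f u v) x y ℕ.+ nullity (merge (merge f u v) x y) S
      ≡⟨ cong₂ ℕ._+_ (loopCount-swap f u v x y)
           (nullity-kernel (merge-comm f u v x y) (merge-comm f x y u v) S) ⟩
    loopCount f x y ℕ.+ loopCount (merge f x y) u v ℕ.+ nullity (merge (merge f x y) u v) S
      ≡⟨ ℕₚ.+-assoc (loopCount f x y) _ _ ⟩
    loopCount f x y ℕ.+ (loopCount (merge f x y) u v ℕ.+ nullity (merge (merge f x y) u v) S) ∎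
    where open ≡-Reasoning

  -- The hypothesis ranges over all labellings because the head arc changes the labelling under
  -- which the tails are compared.
  nullity-∷ : ∀ S T → (∀ f → nullity f S ≡ nullity f T) → ∀ f e → nullity f (e ∷ S) ≡ nullity f (e ∷ T)
  nullity-∷ S T eq f (u , v) = cong (loopCount f u v ℕ.+_) (eq (merge f u v))

  nullity-↭ : S ↭ T → ∀ f → nullity f S ≡ nullity f T
  nullity-↭ ↭.refl f = refl
  nullity-↭ (prep {S} {T} e p) f = nullity-∷ S T (nullity-↭ p) f e
  nullity-↭ (swap {S} {T} a b p) f =
    trans (nullity-swap f a b S) (nullity-∷ (a ∷ S) (a ∷ T) (λ g → nullity-∷ S T (nullity-↭ p) g a) f b)
  nullity-↭ (↭.trans p q) f = trans (nullity-↭ p f) (nullity-↭ q f)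

  contractAll : (V → ℕ) → List Arc → V → ℕ
  contractAll f [] = f
  contractAll f ((u , v) ∷ S) = contractAll (merge f u v) S

  contractAll-⊒ : ∀ S → f ⊑ contractAll f S
  contractAll-⊒ [] p = p
  contractAll-⊒ {f} ((u , v) ∷ S) p = contractAll-⊒ S (merge-⊒ {f} {u} {v} p)

  contractAll-∈ : ∀ f S → (u , v) ∈ S → contractAll f S u ≡ contractAll f S v
  contractAll-∈ f ((u , v) ∷ S) (here refl) = contractAll-⊒ S (merge-ends f u v)
  contractAll-∈ f ((_ , _) ∷ S) (there i) = contractAll-∈ _ S i

  -- As the order of the arcs is irrelevant, `(u , v)` may be treated last; it then counts exactly
  -- when the other arcs already connect its ends.
  nullity-last : ∀ f u v S → nullity f ((u , v) ∷ S) ≡ nullity f S ℕ.+ loopCount (contractAll f S) u v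
  nullity-last f u v [] = ℕₚ.+-identityʳ _
  nullity-last f u v ((x , y) ∷ S) = begin
    nullity f ((u , v) ∷ (x , y) ∷ S) ≡⟨ nullity-swap f (u , v) (x , y) S ⟩
    loopCount f x y ℕ.+ nullity (merge f x y) ((u , v) ∷ S)
      ≡⟨ cong (loopCount f x y ℕ.+_) (nullity-last (merge f x y) u v S) ⟩
    loopCount f x y ℕ.+ (nullity (merge f x y) S ℕ.+ loopCount (contractAll (merge f x y) S) u v)
      ≡⟨ ℕₚ.+-assoc (loopCount f x y) _ _ ⟨
    nullity f ((x , y) ∷ S) ℕ.+ loopCount (contractAll f ((x , y) ∷ S)) u v ∎
    where open ≡-Reasoning

  -- Directed paths in a contraction

  data Path (f : V → ℕ) (S : List Arc) : V → V → Set where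
    -- Equality of labels instead of vertices lets a path jump freely inside a merged class.
    nil  : f x ≡ f y → Path f S x y
    step : f x ≡ f u → (u , v) ∈ S → Path f S v y → Path f S x y

  Path-trans : Path f S x y → Path f S y z → Path f S x z
  Path-trans (nil p) (nil q) = nil (trans p q)
  Path-trans (nil p) (step q i r) = step (trans p q) i r
  Path-trans (step p i q) r = step p i (Path-trans q r)

  Path-map : (∀ {x y} → f x ≡ f y → Path g T x y) → (∀ {x y} → (x , y) ∈ S → Path g T x y) →
             Path f S x y → Path g T x y
  Path-map h k (nil p) = h p
  Path-map h k (step p i q) = Path-trans (h p) (Path-trans (k i) (Path-map h k q))

  arc : (x , y) ∈ S → Path f S x y
  arc i = step refl i (nil refl)

  Path-⊆ : (∀ {e} → e ∈ S → e ∈ T) → Path f S x y → Path f T x y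
  Path-⊆ h = Path-map nil (λ i → arc (h i))

  -- Cut the path before its first and after its last use of the new arc.
  Path-∷⁻ : Path f ((u , v) ∷ S) x y → Path f S x y ⊎ (Path f S x u × Path f S v y)
  Path-∷⁻ (nil p) = inj₁ (nil p)
  Path-∷⁻ (step p (here refl) q) with Path-∷⁻ q
  ... | inj₁ r = inj₂ (nil p , r)
  ... | inj₂ (_ , r) = inj₂ (nil p , r)
  Path-∷⁻ (step p (there i) q) with Path-∷⁻ q
  ... | inj₁ r = inj₁ (step p i r)
  ... | inj₂ (r , s) = inj₂ (step p i r , s)

  -- Decided by admitting the arcs one at a time, as in the Floyd-Warshall algorithm.
  path? : ∀ f S x y → Dec (Path f S x y)
  path? f [] x y = map′ nil (λ { (nil p) → p }) (f x ℕ.≟ f y)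
  path? f ((u , v) ∷ S) x y =
    map′ (λ { (inj₁ p) → Path-⊆ there p
            ; (inj₂ (p , q)) → Path-trans (Path-⊆ there p) (step refl (here refl) (Path-⊆ there q)) })
         Path-∷⁻ (path? f S x y ⊎-dec (path? f S x u ×-dec path? f S v y))

  -- A path in the contraction that uses the identification of u with v can be cut at
  -- its first and at its last visit to the merged vertex.
  Path-merge⁻ : Path (merge f u v) S x y →
    Path f S x y ⊎ ∃ λ p → ∃ λ q → (p ≡ u ⊎ p ≡ v) × (q ≡ u ⊎ q ≡ v) × Path f S x p × Path f S q y
  Path-merge⁻ {f} {u} {v} {S} = go
    where
    Ends : V → V → Set
    Ends x y = ∃ λ p → ∃ λ q → (p ≡ u ⊎ p ≡ v) × (q ≡ u ⊎ q ≡ v) × Path f S x p × Path f S q y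

    split : merge f u v x ≡ merge f u v y → f x ≡ f y ⊎ Ends x y
    split {x} {y} eq with merge-≡ f u v eq
    ... | inj₁ r = inj₁ r
    ... | inj₂ (inj₁ r , inj₁ s) = inj₂ (u , u , inj₁ refl , inj₁ refl , nil r , nil (sym s))
    ... | inj₂ (inj₁ r , inj₂ s) = inj₂ (u , v , inj₁ refl , inj₂ refl , nil r , nil (sym s))
    ... | inj₂ (inj₂ r , inj₁ s) = inj₂ (v , u , inj₂ refl , inj₁ refl , nil r , nil (sym s))
    ... | inj₂ (inj₂ r , inj₂ s) = inj₂ (v , v , inj₂ refl , inj₂ refl , nil r , nil (sym s))

    go : Path (merge f u v) S x y → Path f S x y ⊎ Ends x y
    go (nil p) with split p
    ... | inj₁ r = inj₁ (nil r)
    ... | inj₂ r = inj₂ r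
    go (step p i r) with split p | go r
    ... | inj₁ s | inj₁ t = inj₁ (step s i t)
    ... | inj₁ s | inj₂ (a , b , a∈ , b∈ , t , t′) = inj₂ (a , b , a∈ , b∈ , step s i t , t′)
    ... | inj₂ (a , b , a∈ , b∈ , s , s′) | inj₁ t =
      inj₂ (a , b , a∈ , b∈ , s , Path-trans s′ (step refl i t))
    ... | inj₂ (a , _ , a∈ , _ , s , _) | inj₂ (_ , b , _ , b∈ , _ , t′) = inj₂ (a , b , a∈ , b∈ , s , t′)

  -- Each jump between the two merged classes is replaced by one of the given paths.
  Path-unmerge : Path f S u v → Path f S v u → Path (merge f u v) S x y → Path f S x y
  Path-unmerge {f} {S} {u} {v} a b = Path-map jump arc
    where
    jump : merge f u v x ≡ merge f u v y → Path f S x y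
    jump eq with merge-≡ f u v eq
    ... | inj₁ r = nil r
    ... | inj₂ (inj₁ r , inj₁ s) = nil (trans r (sym s))
    ... | inj₂ (inj₁ r , inj₂ s) = Path-trans (nil r) (Path-trans a (nil (sym s)))
    ... | inj₂ (inj₂ r , inj₁ s) = Path-trans (nil r) (Path-trans b (nil (sym s)))
    ... | inj₂ (inj₂ r , inj₂ s) = nil (trans r (sym s))

  Path-merge : Path f S x y → Path (merge f u v) S x y
  Path-merge {f} {u = u} {v = v} = Path-map (λ p → nil (merge-⊒ {f} {u} {v} p)) arc

  Path-merge-∷ : Path f ((u , v) ∷ S) x y → Path (merge f u v) S x y
  Path-merge-∷ {f} {u} {v} = Path-map (λ p → nil (merge-⊒ {f} {u} {v} p))
    (λ { (here refl) → nil (merge-ends f u v) ; (there i) → arc i })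

  Path-contractAll : Path f S x y → contractAll f S x ≡ contractAll f S y
  Path-contractAll {f} {S} (nil p) = contractAll-⊒ S p
  Path-contractAll {f} {S} (step p i q) =
    trans (contractAll-⊒ S p) (trans (contractAll-∈ f S i) (Path-contractAll q))

  -- Cyclic and acyclic arc lists

  Cyclic : (V → ℕ) → List Arc → Set
  Cyclic f S = ∀ {x y} → (x , y) ∈ S → Path f S y x

  allArcs? : ∀ {P : Arc → Set} → (∀ e → Dec (P e)) → ∀ S → Dec (∀ {x y} → (x , y) ∈ S → P (x , y))
  allArcs? P? S = map′ (λ a i → All.lookup a i) (λ h → All.tabulate h) (All.all? P? S)

  cyclic? : ∀ f S → Dec (Cyclic f S)
  cyclic? f S = allArcs? (λ e → path? f S (proj₂ e) (proj₁ e)) S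

  -- Loops of the contraction are excluded too, since `nil` is a return path for them.
  Acyclic : (V → ℕ) → List Arc → Set
  Acyclic f S = ∀ {x y} → (x , y) ∈ S → ¬ Path f S y x

  acyclic? : ∀ f S → Dec (Acyclic f S)
  acyclic? f S = allArcs? (λ e → ¬? (path? f S (proj₂ e) (proj₁ e))) S

  -- Every arc is traversed backwards along its return path.
  Cyclic-Path-sym : Cyclic f S → Path f S x y → Path f S y x
  Cyclic-Path-sym c (nil p) = nil (sym p)
  Cyclic-Path-sym c (step p i q) = Path-trans (Cyclic-Path-sym c q) (Path-trans (c i) (nil (sym p)))

  -- A return path from `v` that uses the arc has already reached `u` before the first use and can
  -- stop there.
  Cyclic-return : Cyclic f ((u , v) ∷ S) → Path f S v u
  Cyclic-return c with Path-∷⁻ (c (here refl))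
  ... | inj₁ p = p
  ... | inj₂ (p , _) = p

  Cyclic-contract : Cyclic f ((u , v) ∷ S) → Cyclic (merge f u v) S
  Cyclic-contract c i = Path-merge-∷ (c (there i))

  Cyclic-merge : Cyclic f S → Cyclic (merge f u v) S
  Cyclic-merge c i = Path-merge (c i)

  -- The arc and its return path together make `u` and `v` mutually reachable, so closed walks of
  -- the contraction lift.
  Cyclic-uncontract : Path f S v u → Cyclic (merge f u v) S → Cyclic f ((u , v) ∷ S)
  Cyclic-uncontract p c (here refl) = Path-⊆ there p
  Cyclic-uncontract p c (there i) =
    Path-unmerge (arc (here refl)) (Path-⊆ there p) (Path-⊆ there (c i))

  Cyclic-unmerge : Path f S u v → Path f S v u → Cyclic (merge f u v) S → Cyclic f S
  Cyclic-unmerge p q c i = Path-unmerge p q (c i)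

  -- A closed walk in the contraction through an arc either lifts to a closed walk, or
  -- runs through the arc from one of the ends u, v to the other.
  lift-cycle : (x , y) ∈ S → Path (merge f u v) S y x → Path f S y x ⊎ (Path f S u v ⊎ Path f S v u)
  lift-cycle i c with Path-merge⁻ c
  ... | inj₁ p = inj₁ p
  ... | inj₂ (_ , _ , inj₁ refl , inj₁ refl , p , q) = inj₁ (Path-trans p q)
  ... | inj₂ (_ , _ , inj₂ refl , inj₂ refl , p , q) = inj₁ (Path-trans p q)
  ... | inj₂ (_ , _ , inj₁ refl , inj₂ refl , p , q) = inj₂ (inj₂ (Path-trans q (step refl i p)))
  ... | inj₂ (_ , _ , inj₂ refl , inj₁ refl , p , q) = inj₂ (inj₁ (Path-trans q (step refl i p)))

  -- A closed walk that does not lift would contain a path between `u` and `v`.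
  Cyclic-unmerge-¬ : ¬ Path f S u v → ¬ Path f S v u → Cyclic (merge f u v) S → Cyclic f S
  Cyclic-unmerge-¬ ¬p ¬q c i with lift-cycle i (c i)
  ... | inj₁ r = r
  ... | inj₂ (inj₁ r) = ⊥-elim (¬p r)
  ... | inj₂ (inj₂ r) = ⊥-elim (¬q r)

  -- Weakly connected vertices are strongly connected here: the identification made by each
  -- contracted arc is realised by the arc and its return path.
  Cyclic-contractAll : Cyclic f S → contractAll f S x ≡ contractAll f S y → Path f S x y
  Cyclic-contractAll {S = []} c p = nil p
  Cyclic-contractAll {S = (u , v) ∷ S} c p =
    Path-unmerge (arc (here refl)) (c (here refl))
      (Path-⊆ there (Cyclic-contractAll (Cyclic-contract c) p))

  Cyclic-loop : f u ≡ f v → Cyclic f ((u , v) ∷ S) → Cyclic f S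
  Cyclic-loop {f} {u} {v} {S} p c i =
    Path-map nil (λ { (here refl) → nil p ; (there j) → arc j }) (c (there i))

  Cyclic-loop⁻ : f u ≡ f v → Cyclic f S → Cyclic f ((u , v) ∷ S)
  Cyclic-loop⁻ p c (here refl) = nil (sym p)
  Cyclic-loop⁻ p c (there i) = Path-⊆ there (c i)

  Cyclic-↭ : S ↭ T → Cyclic f S → Cyclic f T
  Cyclic-↭ p c i = Path-⊆ (∈-resp-↭ p) (c (∈-resp-↭ (↭-sym p) i))

  Acyclic-↭ : S ↭ T → Acyclic f S → Acyclic f T
  Acyclic-↭ p c i q = c (∈-resp-↭ (↭-sym p) i) (Path-⊆ (∈-resp-↭ (↭-sym p)) q)

  -- Signed weights and the contraction identity

  abstract
    weight : (V → ℕ) → List Arc → ℤ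
    weight f S = if does (cyclic? f S) then signPow (nullity f S) else + 0

    weight-cyclic : Cyclic f S → weight f S ≡ signPow (nullity f S)
    weight-cyclic {f} {S} c =
      cong (λ b → if b then signPow (nullity f S) else + 0) (dec-true (cyclic? f S) c)

    weight-¬cyclic : ¬ Cyclic f S → weight f S ≡ + 0
    weight-¬cyclic {f} {S} ¬c =
      cong (λ b → if b then signPow (nullity f S) else + 0) (dec-false (cyclic? f S) ¬c)

    acyc : (V → ℕ) → List Arc → ℤ
    acyc f S = if does (acyclic? f S) then + 1 else + 0

    acyc-acyclic : Acyclic f S → acyc f S ≡ + 1
    acyc-acyclic {f} {S} c = cong (λ b → if b then + 1 else + 0) (dec-true (acyclic? f S) c)

    acyc-¬acyclic : ¬ Acyclic f S → acyc f S ≡ + 0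
    acyc-¬acyclic {f} {S} c = cong (λ b → if b then + 1 else + 0) (dec-false (acyclic? f S) c)

  weight-⇔ : (Cyclic f S → Cyclic g T) → (Cyclic g T → Cyclic f S) → nullity f S ≡ nullity g T →
             weight f S ≡ weight g T
  weight-⇔ {f} {S} to from eq with cyclic? f S
  ... | yes c = trans (weight-cyclic c) (trans (cong signPow eq) (sym (weight-cyclic (to c))))
  ... | no ¬c = trans (weight-¬cyclic ¬c) (sym (weight-¬cyclic (λ c → ¬c (from c))))

  acyc-⇔ : (Acyclic f S → Acyclic g T) → (Acyclic g T → Acyclic f S) → acyc f S ≡ acyc g T
  acyc-⇔ {f} {S} to from with acyclic? f S
  ... | yes c = trans (acyc-acyclic c) (sym (acyc-acyclic (to c)))
  ... | no ¬c = trans (acyc-¬acyclic ¬c) (sym (acyc-¬acyclic (λ c → ¬c (from c))))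

  weight-↭ : S ↭ T → weight f S ≡ weight f T
  weight-↭ {f = f} p = weight-⇔ (Cyclic-↭ p) (Cyclic-↭ (↭-sym p)) (nullity-↭ p f)

  acyc-↭ : S ↭ T → acyc f S ≡ acyc f T
  acyc-↭ p = acyc-⇔ (Acyclic-↭ p) (Acyclic-↭ (↭-sym p))

  weight-loop : f u ≡ f v → ∀ S → weight f ((u , v) ∷ S) ≡ - weight f S
  weight-loop {f} p S with cyclic? f S
  ... | yes c = trans (weight-cyclic (Cyclic-loop⁻ p c))
                  (trans (cong signPow (nullity-loop p S)) (cong -_ (sym (weight-cyclic c))))
  ... | no ¬c = trans (weight-¬cyclic (λ c → ¬c (Cyclic-loop p c))) (cong -_ (sym (weight-¬cyclic ¬c)))

  -- Treat the arc `(u , v)` in two ways: placed first it is contracted as a non-loop, placed last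
  -- it counts as a loop.
  nullity-joined : f u ≢ f v → Path f S u v → nullity (merge f u v) S ≡ suc (nullity f S)
  nullity-joined {f} {u} {v} {S} ne p = begin
    nullity (merge f u v) S  ≡⟨ nullity-nonloop ne S ⟨
    nullity f ((u , v) ∷ S)  ≡⟨ nullity-last f u v S ⟩
    nullity f S ℕ.+ loopCount (contractAll f S) u v
      ≡⟨ cong (nullity f S ℕ.+_) (loopCount-loop {contractAll f S} (Path-contractAll p)) ⟩
    nullity f S ℕ.+ 1        ≡⟨ ℕₚ.+-comm _ 1 ⟩
    suc (nullity f S)        ∎
    where open ≡-Reasoning

  -- The same comparison of the arc placed first and last; cyclicity turns the absence of a directed
  -- path into weak disconnection, so the arc is no loop at the end either.
  nullity-separated : f u ≢ f v → Cyclic f S → ¬ Path f S u v → nullity (merge f u v) S ≡ nullity f S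
  nullity-separated {f} {u} {v} {S} ne c ¬p = begin
    nullity (merge f u v) S  ≡⟨ nullity-nonloop ne S ⟨
    nullity f ((u , v) ∷ S)  ≡⟨ nullity-last f u v S ⟩
    nullity f S ℕ.+ loopCount (contractAll f S) u v
      ≡⟨ cong (nullity f S ℕ.+_) (loopCount-nonloop {contractAll f S} (λ q → ¬p (Cyclic-contractAll c q))) ⟩
    nullity f S ℕ.+ 0        ≡⟨ ℕₚ.+-identityʳ _ ⟩
    nullity f S              ∎
    where open ≡-Reasoning

  nullity-flip : f u ≢ f v → ∀ S → nullity f ((v , u) ∷ S) ≡ nullity (merge f u v) S
  nullity-flip {f} {u} {v} ne S = trans (nullity-nonloop (λ p → ne (sym p)) S)
    (nullity-kernel (merge-sym f v u) (merge-sym f u v) S)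

  Cyclic-merge-sym : Cyclic (merge f u v) S → Cyclic (merge f v u) S
  Cyclic-merge-sym {f} {u} {v} c i = Path-map (λ p → nil (merge-sym f u v p)) arc (c i)

  -- In terms of nonnegative circulations: the open face of the contraction with support S
  -- is cut by the sign of the flow through (u , v).
  weight-contract : f u ≢ f v → ∀ S →
    weight (merge f u v) S ≡ weight f S + (weight f ((u , v) ∷ S) + weight f ((v , u) ∷ S))
  weight-contract {f} {u} {v} ne S with cyclic? (merge f u v) S
  ... | no ¬c = trans (weight-¬cyclic ¬c) (sym (cong₂ _+_ (weight-¬cyclic (λ c → ¬c (Cyclic-merge c)))
        (cong₂ _+_ (weight-¬cyclic (λ c → ¬c (Cyclic-contract c)))
                   (weight-¬cyclic (λ c → ¬c (Cyclic-merge-sym (Cyclic-contract c)))))))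
  ... | yes c = trans (weight-cyclic c) (cases (path? f S u v) (path? f S v u))
    where
    s : ℤ
    s = signPow (nullity (merge f u v) S)

    with-arc : Path f S v u → weight f ((u , v) ∷ S) ≡ s
    with-arc q = trans (weight-cyclic (Cyclic-uncontract q c)) (cong signPow (nullity-nonloop ne S))

    with-flip : Path f S u v → weight f ((v , u) ∷ S) ≡ s
    with-flip p = trans (weight-cyclic (Cyclic-uncontract p (Cyclic-merge-sym c))) (cong signPow (nullity-flip ne S))

    without-arc : ¬ Path f S v u → weight f ((u , v) ∷ S) ≡ + 0
    without-arc ¬q = weight-¬cyclic (λ d → ¬q (Cyclic-return d))

    without-flip : ¬ Path f S u v → weight f ((v , u) ∷ S) ≡ + 0
    without-flip ¬p = weight-¬cyclic (λ d → ¬p (Cyclic-return d))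

    cases : Dec (Path f S u v) → Dec (Path f S v u) →
            s ≡ weight f S + (weight f ((u , v) ∷ S) + weight f ((v , u) ∷ S))
    -- All three supports are cyclic, and `S` alone has nullity one less than its contraction: `s`
    -- is `- s + s + s`.
    cases (yes p) (yes q) = begin
      s              ≡⟨ ℤₚ.+-identityˡ s ⟨
      + 0 + s        ≡⟨ cong (_+ s) (ℤₚ.+-inverseˡ s) ⟨
      - s + s + s    ≡⟨ ℤₚ.+-assoc (- s) s s ⟩
      - s + (s + s)  ≡⟨ cong₂ _+_ -s≡ (cong₂ _+_ (sym (with-arc q)) (sym (with-flip p))) ⟩
      _ ∎
      where
      open ≡-Reasoning
      -s≡ : - s ≡ weight f S
      -s≡ = trans (cong (λ k → - signPow k) (nullity-joined ne p))
        (trans (ℤₚ.neg-involutive _) (sym (weight-cyclic (Cyclic-unmerge p q c))))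
    -- Only the reversed arc closes up; `S` itself is not cyclic, as otherwise the path could be
    -- reversed.
    cases (yes p) (no ¬q) = sym (trans
      (cong₂ _+_ (weight-¬cyclic (λ d → ¬q (Cyclic-Path-sym d p))) (cong₂ _+_ (without-arc ¬q) (with-flip p)))
      (trans (ℤₚ.+-identityˡ _) (ℤₚ.+-identityˡ _)))
    cases (no ¬p) (yes q) = sym (trans
      (cong₂ _+_ (weight-¬cyclic (λ d → ¬p (Cyclic-Path-sym d q))) (cong₂ _+_ (with-arc q) (without-flip ¬p)))
      (trans (ℤₚ.+-identityˡ _) (ℤₚ.+-identityʳ _)))
    -- Neither orientation has a return path, so only `S` contributes, with unchanged nullity.
    cases (no ¬p) (no ¬q) = sym (trans
      (cong₂ _+_ (trans (weight-cyclic d) (cong signPow (sym (nullity-separated ne d ¬p))))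
                 (cong₂ _+_ (without-arc ¬q) (without-flip ¬p)))
      (ℤₚ.+-identityʳ _))
      where d = Cyclic-unmerge-¬ ¬p ¬q c

  -- Acyclicity under contraction

  Acyclic-tail : Acyclic f ((u , v) ∷ S) → Acyclic f S
  Acyclic-tail c i p = c (there i) (Path-⊆ there p)

  Acyclic-∷ : Acyclic f S → ¬ Path f S v u → Acyclic f ((u , v) ∷ S)
  Acyclic-∷ c ¬p (here refl) q with Path-∷⁻ q
  ... | inj₁ r = ¬p r
  ... | inj₂ (r , _) = ¬p r
  Acyclic-∷ c ¬p (there i) q with Path-∷⁻ q
  ... | inj₁ r = c i r
  ... | inj₂ (r , r′) = ¬p (Path-trans r′ (step refl i r))

  Acyclic-unmerge : Acyclic (merge f u v) S → Acyclic f S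
  Acyclic-unmerge c i p = c i (Path-merge p)

  -- A path between the two distinct ends closes up to a cycle in the contraction.
  Acyclic-merge-¬Path : f u ≢ f v → Acyclic (merge f u v) S → ¬ Path f S u v
  Acyclic-merge-¬Path ne c (nil p) = ne p
  Acyclic-merge-¬Path {f} {u} {v} ne c (step p i q) =
    c i (Path-trans (Path-merge q) (nil (trans (sym (merge-ends f u v)) (merge-⊒ p))))

  Acyclic-merge : Acyclic f S → ¬ Path f S u v → ¬ Path f S v u → Acyclic (merge f u v) S
  Acyclic-merge c ¬p ¬q i r with lift-cycle i r
  ... | inj₁ s = c i s
  ... | inj₂ (inj₁ s) = ¬p s
  ... | inj₂ (inj₂ s) = ¬q s

  -- If the first path has an arc, the rest of it and the second path form a return path for that
  -- arc.
  Acyclic-antisym : Acyclic f S → Path f S x y → Path f S y x → f x ≡ f y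
  Acyclic-antisym c (nil p) q = p
  Acyclic-antisym c (step p i r) q = ⊥-elim (c i (Path-trans r (Path-trans q (nil p))))

  -- For acyclic `S` at most one end reaches the other. If one does, just one orientation stays
  -- acyclic and contraction creates a cycle; if none does, all four terms are 1.
  acyc-contract : f u ≢ f v → ∀ S →
    acyc f ((u , v) ∷ S) + acyc f ((v , u) ∷ S) ≡ acyc f S + acyc (merge f u v) S
  acyc-contract {f} {u} {v} ne S with acyclic? f S
  ... | no ¬c = trans (cong₂ _+_ (acyc-¬acyclic (λ c → ¬c (Acyclic-tail c)))
                               (acyc-¬acyclic (λ c → ¬c (Acyclic-tail c))))
                 (sym (cong₂ _+_ (acyc-¬acyclic ¬c) (acyc-¬acyclic (λ c → ¬c (Acyclic-unmerge c)))))
  ... | yes c = cases (path? f S u v) (path? f S v u)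
    where
    cases : Dec (Path f S u v) → Dec (Path f S v u) →
      acyc f ((u , v) ∷ S) + acyc f ((v , u) ∷ S) ≡ acyc f S + acyc (merge f u v) S
    cases (yes p) (yes q) = ⊥-elim (ne (Acyclic-antisym c p q))
    cases (yes p) (no ¬q) =
      trans (cong₂ _+_ (acyc-acyclic (Acyclic-∷ c ¬q)) (acyc-¬acyclic (λ d → d (here refl) (Path-⊆ there p))))
       (sym (cong₂ _+_ (acyc-acyclic c) (acyc-¬acyclic (λ d → Acyclic-merge-¬Path ne d p))))
    cases (no ¬p) (yes q) =
      trans (cong₂ _+_ (acyc-¬acyclic (λ d → d (here refl) (Path-⊆ there q))) (acyc-acyclic (Acyclic-∷ c ¬p)))
       (sym (cong₂ _+_ (acyc-acyclic c)
         (acyc-¬acyclic (λ d → Acyclic-merge-¬Path (λ r → ne (sym r)) (merge-swap d) q))))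
      where
      merge-swap : Acyclic (merge f u v) S → Acyclic (merge f v u) S
      merge-swap d i r = d i (Path-map (λ r → nil (merge-sym f v u r)) arc r)
    cases (no ¬p) (no ¬q) =
      trans (cong₂ _+_ (acyc-acyclic (Acyclic-∷ c ¬q)) (acyc-acyclic (Acyclic-∷ c ¬p)))
       (sym (cong₂ _+_ (acyc-acyclic c) (acyc-acyclic (Acyclic-merge c ¬p ¬q))))

  -- Sums over sublists

  private variable
    w w′ : List Arc → ℤ

  sumSub : (List Arc → ℤ) → List Arc → ℤ
  sumSub w [] = w []
  sumSub w (e ∷ A) = sumSub w A + sumSub (λ S → w (e ∷ S)) A

  sumSub-cong : (∀ S → w S ≡ w′ S) → ∀ A → sumSub w A ≡ sumSub w′ A
  sumSub-cong eq [] = eq []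
  sumSub-cong eq (e ∷ A) = cong₂ _+_ (sumSub-cong eq A) (sumSub-cong (λ S → eq (e ∷ S)) A)

  sumSub-+ : ∀ w w′ A → sumSub (λ S → w S + w′ S) A ≡ sumSub w A + sumSub w′ A
  sumSub-+ w w′ [] = refl
  sumSub-+ w w′ (e ∷ A) =
    trans (cong₂ _+_ (sumSub-+ w w′ A) (sumSub-+ (λ S → w (e ∷ S)) (λ S → w′ (e ∷ S)) A))
          (+-interchange (sumSub w A) _ _ _)

  sumSub-neg : ∀ w A → sumSub (λ S → - w S) A ≡ - sumSub w A
  sumSub-neg w [] = refl
  sumSub-neg w (e ∷ A) =
    trans (cong₂ _+_ (sumSub-neg w A) (sumSub-neg (λ S → w (e ∷ S)) A)) (sym (ℤₚ.neg-distrib-+ (sumSub w A) _))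

  sumSub-↭ : (∀ {S T} → S ↭ T → w S ≡ w T) → S ↭ T → sumSub w S ≡ sumSub w T
  sumSub-↭ inv ↭.refl = refl
  sumSub-↭ inv (prep e p) = cong₂ _+_ (sumSub-↭ inv p) (sumSub-↭ (λ q → inv (prep e q)) p)
  sumSub-↭ {w} inv (swap {xs = S} {ys = T} a b p) =
    -- The sublists are sorted by which of `a`, `b` they contain; the two mixed terms trade places.
    trans (+-interchange (sumSub w S) _ _ _)
      (cong₂ _+_ (cong₂ _+_ (sumSub-↭ inv p) (sumSub-↭ (λ q → inv (prep a q)) p))
                 (cong₂ _+_ (sumSub-↭ (λ q → inv (prep b q)) p)
                    (trans (sumSub-↭ (λ q → inv (prep a (prep b q))) p)
                           (sumSub-cong (λ S → inv (swap a b ↭.refl)) T))))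
  sumSub-↭ inv (↭.trans p q) = trans (sumSub-↭ inv p) (sumSub-↭ inv q)

  sumSub-0 : ∀ {P : Arc → Set} → (∀ {S} → All P S → w S ≡ + 0) → All P A → sumSub w A ≡ + 0
  sumSub-0 z [] = z []
  sumSub-0 z (p ∷ ps) = cong₂ _+_ (sumSub-0 z ps) (sumSub-0 (λ qs → z (p ∷ qs)) ps)

  -- Euler characteristic

  χ : (V → ℕ) → List Arc → ℤ
  χ f = sumSub (weight f)

  -- Sublists with and without the loop pair off with opposite weights.
  χ-loop : f u ≡ f v → ∀ A → χ f ((u , v) ∷ A) ≡ + 0
  χ-loop {f} p A = trans (cong (λ k → χ f A + k) (trans (sumSub-cong (weight-loop p) A) (sumSub-neg (weight f) A)))
    (ℤₚ.+-inverseʳ (χ f A))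

  -- Sum `weight-contract` over all sublists of `A`. The left side contains `χ f A` twice; one copy
  -- is absorbed into the contraction, the other remains.
  χ-contract : f u ≢ f v → ∀ A → χ f ((u , v) ∷ A) + χ f ((v , u) ∷ A) ≡ χ f A + χ (merge f u v) A
  χ-contract {f} {u} {v} ne A = begin
    (a + b) + (a + c)  ≡⟨ ℤₚ.+-assoc a b (a + c) ⟩
    a + (b + (a + c))  ≡⟨ cong (λ k → a + k) (CommutativeSemigroup.x∙yz≈y∙xz ℤₚ.+-commutativeSemigroup b a c) ⟩
    a + (a + (b + c))  ≡⟨ cong (λ k → a + (a + k)) (sumSub-+ w₁ w₂ A) ⟨
    a + (a + sumSub (λ S → w₁ S + w₂ S) A)
                       ≡⟨ cong (λ k → a + k) (sumSub-+ (weight f) _ A) ⟨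
    a + sumSub (λ S → weight f S + (w₁ S + w₂ S)) A
                       ≡⟨ cong (λ k → a + k) (sumSub-cong (λ S → sym (weight-contract ne S)) A) ⟩
    a + χ (merge f u v) A ∎
    where
    open ≡-Reasoning
    w₁ w₂ : List Arc → ℤ
    w₁ S = weight f ((u , v) ∷ S)
    w₂ S = weight f ((v , u) ∷ S)
    a b c : ℤ
    a = χ f A
    b = sumSub w₁ A
    c = sumSub w₂ A

  Ascending : (V → ℕ) → Arc → Set
  Ascending f (u , v) = f u < f v

  Ascending-Path : All (Ascending f) S → Path f S x y → f x ≤ f y
  Ascending-Path a (nil p) = ℕₚ.≤-reflexive p
  Ascending-Path a (step p i q) =
    ℕₚ.≤-trans (ℕₚ.≤-reflexive p) (ℕₚ.≤-trans (ℕₚ.<⇒≤ (All.lookup a i)) (Ascending-Path a q))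

  Ascending-Acyclic : All (Ascending f) S → Acyclic f S
  Ascending-Acyclic a i p = ℕₚ.<⇒≱ (All.lookup a i) (Ascending-Path a p)

  -- Labels never decrease along paths, so no nonempty sublist is cyclic and only the empty one
  -- contributes.
  χ-Ascending : All (Ascending f) A → χ f A ≡ + 1
  χ-Ascending [] = weight-cyclic (λ ())
  χ-Ascending (p ∷ ps) = cong₂ _+_ (χ-Ascending ps)
    (sumSub-0 (λ qs → weight-¬cyclic (λ c → Ascending-Acyclic (p ∷ qs) (here refl) (c (here refl)))) ps)

  mutual
    -- The bound `N` drops when an arc is removed or contracted; between such steps the list of arcs
    -- still to be turned gets shorter.
    χ≡acyc : ∀ N f A → length A ≤ N → χ f A ≡ acyc f A
    χ≡acyc N f A = χ≡acyc-++ N f [] A []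

    -- The arcs of the second list are turned one at a time until all arcs ascend.
    χ≡acyc-++ : ∀ N f P R → All (Ascending f) P → length (P ++ R) ≤ N → χ f (P ++ R) ≡ acyc f (P ++ R)
    χ≡acyc-++ N f P [] a len rewrite ++-identityʳ P =
      trans (χ-Ascending a) (sym (acyc-acyclic (Ascending-Acyclic a)))
    χ≡acyc-++ N f P ((u , v) ∷ R) a len =
      trans (sumSub-↭ weight-↭ σ) (trans (cases N (ℕₚ.<-cmp (f u) (f v)) len′) (sym (acyc-↭ σ)))
      where
      σ : P ++ (u , v) ∷ R ↭ (u , v) ∷ P ++ R
      σ = shift (u , v) P R

      len′ : suc (length (P ++ R)) ≤ N
      len′ = subst (_≤ N) (↭-length σ) len

      cases : ∀ N → Tri (f u < f v) (f u ≡ f v) (f v < f u) → suc (length (P ++ R)) ≤ N →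
              χ f ((u , v) ∷ P ++ R) ≡ acyc f ((u , v) ∷ P ++ R)
      cases N (tri< lt _ _) le = χ≡acyc-++ N f ((u , v) ∷ P) R (lt ∷ a) le
      cases N (tri≈ _ eq _) le =
        trans (χ-loop eq (P ++ R)) (sym (acyc-¬acyclic (λ c → c (here refl) (nil (sym eq)))))
      cases (suc N) (tri> _ ne gt) le@(s≤s le′) =
       -- After reversal the arc ascends, so the inner recursion settles that list; its value
       -- cancels from the two contraction identities.
       Group.∙-cancelʳ (AbelianGroup.group ℤₚ.+-0-abelianGroup) (χ f ((v , u) ∷ P ++ R)) _ _ (begin
        χ f ((u , v) ∷ P ++ R) + χ f ((v , u) ∷ P ++ R)  ≡⟨ χ-contract ne (P ++ R) ⟩
        χ f (P ++ R) + χ (merge f u v) (P ++ R)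
          ≡⟨ cong₂ _+_ (χ≡acyc N f (P ++ R) le′) (χ≡acyc N (merge f u v) (P ++ R) le′) ⟩
        acyc f (P ++ R) + acyc (merge f u v) (P ++ R)    ≡⟨ acyc-contract ne (P ++ R) ⟨
        acyc f ((u , v) ∷ P ++ R) + acyc f ((v , u) ∷ P ++ R)
          ≡⟨ cong (λ k → acyc f ((u , v) ∷ P ++ R) + k) (χ≡acyc-++ (suc N) f ((v , u) ∷ P) R (gt ∷ a) le) ⟨
        acyc f ((u , v) ∷ P ++ R) + χ f ((v , u) ∷ P ++ R) ∎)
        where open ≡-Reasoning

  χ-Cyclic : ∀ {e} → Cyclic f (e ∷ S) → χ f (e ∷ S) ≡ + 0
  χ-Cyclic {f} {S} {e} c = trans (χ≡acyc _ f (e ∷ S) ℕₚ.≤-refl) (acyc-¬acyclic (λ d → d (here refl) (c (here refl))))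

open Contraction

-- Boolean reflection

∨-true⁻ : ∀ {a b} → a ∨ b ≡ true → a ≡ true ⊎ b ≡ true
∨-true⁻ {true}  _ = inj₁ refl
∨-true⁻ {false} p = inj₂ p

∨-trueˡ : ∀ {a b} → a ≡ true → a ∨ b ≡ true
∨-trueˡ refl = refl

∨-trueʳ : ∀ {a b} → b ≡ true → a ∨ b ≡ true
∨-trueʳ {a} refl = Boolₚ.∨-zeroʳ a

∧-true⁻ : ∀ {a b} → a ∧ b ≡ true → a ≡ true × b ≡ true
∧-true⁻ {true} p = refl , p

∧-true : ∀ {a b} → a ≡ true → b ≡ true → a ∧ b ≡ true
∧-true = cong₂ _∧_

true⇔⇒≡ : ∀ {a b} → (a ≡ true → b ≡ true) → (b ≡ true → a ≡ true) → a ≡ b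
true⇔⇒≡ {true}  {b}     to _    = sym (to refl)
true⇔⇒≡ {false} {true}  _  from = from refl
true⇔⇒≡ {false} {false} _  _    = refl

⌊⌋⁻ : ∀ {P : Set} (d : Dec P) → ⌊ d ⌋ ≡ true → P
⌊⌋⁻ (yes p) _ = p

⌊⌋⁺ : ∀ {P : Set} (d : Dec P) → P → ⌊ d ⌋ ≡ true
⌊⌋⁺ (yes _) _ = refl
⌊⌋⁺ (no ¬p) p = ⊥-elim (¬p p)

module _ {k : ℕ} where

  ==⁻ : {i j : Fin k} → (i == j) ≡ true → i ≡ j
  ==⁻ {i} {j} = ⌊⌋⁻ (i Fin.≟ j)

  ==⁺ : {i j : Fin k} → i ≡ j → (i == j) ≡ true
  ==⁺ {i} {j} = ⌊⌋⁺ (i Fin.≟ j)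

anyFin⁻ : ∀ {k} (p : Fin k → Bool) → anyFin p ≡ true → ∃ λ i → p i ≡ true
anyFin⁻ {suc k} p h with ∨-true⁻ {p zero} h
... | inj₁ q = zero , q
... | inj₂ q with i , r ← anyFin⁻ (p ∘ suc) q = suc i , r

anyFin⁺ : ∀ {k} (p : Fin k → Bool) i → p i ≡ true → anyFin p ≡ true
anyFin⁺ p zero    h = ∨-trueˡ h
anyFin⁺ p (suc i) h = ∨-trueʳ {p zero} (anyFin⁺ (p ∘ suc) i h)

allFin?⁺ : ∀ {k} (p : Fin k → Bool) → (∀ i → p i ≡ true) → allFin? p ≡ true
allFin?⁺ p h = Boolₚ.¬-not λ q → case (anyFin⁻ _ (Boolₚ.not-injective q))
  where
  case : ¬ ∃ λ i → not (p i) ≡ true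
  case (i , q) with () ← trans (sym q) (cong not (h i))

allFin?⁻ : ∀ {k} (p : Fin k → Bool) → allFin? p ≡ true → ∀ i → p i ≡ true
allFin?⁻ p h i with p i in eq
... | true  = refl
... | false with () ← trans (sym h) (cong not (anyFin⁺ (λ j → not (p j)) i (cong not eq)))

anyL⁻ : ∀ {X : Set} (p : X → Bool) xs → anyL p xs ≡ true → ∃ λ x → x ∈ xs × p x ≡ true
anyL⁻ p (x ∷ xs) h with ∨-true⁻ {p x} h
... | inj₁ q = x , here refl , q
... | inj₂ q with y , i , r ← anyL⁻ p xs q = y , there i , r

anyL⁺ : ∀ {X : Set} (p : X → Bool) {x xs} → x ∈ xs → p x ≡ true → anyL p xs ≡ true
anyL⁺ p (here refl) h = ∨-trueˡ h
anyL⁺ p {xs = y ∷ _} (there i) h = ∨-trueʳ {p y} (anyL⁺ p i h)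

-- Subsets

private variable
  k : ℕ
  B C : Subset k

infix 4 _∈ₛ_

_∈ₛ_ : Fin k → Subset k → Set
i ∈ₛ B = elem i B ≡ true

subS⁻ : subS B C ≡ true → ∀ {i} → i ∈ₛ B → i ∈ₛ C
subS⁻ {B = B} {C} h {i} p with ∨-true⁻ {not (elem i B)} (allFin?⁻ _ h i)
... | inj₂ q = q
... | inj₁ q with () ← trans (sym q) (cong not p)

subS⁺ : (∀ {i} → i ∈ₛ B → i ∈ₛ C) → subS B C ≡ true
subS⁺ {B = B} {C} h = allFin?⁺ (λ i → not (elem i B) ∨ elem i C) case
  where
  case : ∀ i → not (elem i B) ∨ elem i C ≡ true
  case i with elem i B in eq
  ... | true  = h eq
  ... | false = refl

eqS⁻ : (B C : Subset k) → eqS B C ≡ true → B ≡ C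
eqS⁻ []          []          h = refl
eqS⁻ (true ∷ B)  (true ∷ C)  h = cong (true ∷_) (eqS⁻ B C h)
eqS⁻ (false ∷ B) (false ∷ C) h = cong (false ∷_) (eqS⁻ B C h)

eqS-refl : (B : Subset k) → eqS B B ≡ true
eqS-refl []          = refl
eqS-refl (true ∷ B)  = eqS-refl B
eqS-refl (false ∷ B) = eqS-refl B

⊆-antisym : (∀ {i} → i ∈ₛ B → i ∈ₛ C) → (∀ {i} → i ∈ₛ C → i ∈ₛ B) → B ≡ C
⊆-antisym {B = []} {[]} f g = refl
⊆-antisym {B = b ∷ B} {c ∷ C} f g =
  cong₂ _∷_ (true⇔⇒≡ (f {zero}) (g {zero})) (⊆-antisym (λ {i} → f {suc i}) (λ {i} → g {suc i}))

∈-allSubsets : (B : Subset k) → B ∈ allSubsets k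
∈-allSubsets [] = here refl
∈-allSubsets (false ∷ B) = ∈-++⁺ˡ (∈-map⁺ (false ∷_) (∈-allSubsets B))
∈-allSubsets {suc k} (true ∷ B) = ∈-++⁺ʳ (map (false ∷_) (allSubsets k)) (∈-map⁺ (true ∷_) (∈-allSubsets B))

infix 4 _≼_ _≺_

_≼_ : Subset k → Subset k → Set
_≼_ = Pointwise Bool._≤_

-- `drop` sits at the first index where the sets differ. This suits inductions that contract the
-- common arcs one by one until that index.
data _≺_ : Subset k → Subset k → Set where
  drop : B ≼ C → false ∷ B ≺ true ∷ C
  keep : ∀ b → B ≺ C → b ∷ B ≺ b ∷ C

≼-refl : B ≼ B
≼-refl {B = []}    = []
≼-refl {B = _ ∷ _} = b≤b ∷ ≼-refl

≺⇒≼ : B ≺ C → B ≼ C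
≺⇒≼ (drop p)   = f≤t ∷ p
≺⇒≼ (keep b p) = b≤b ∷ ≺⇒≼ p

subS⇒≼ : (B C : Subset k) → subS B C ≡ true → B ≼ C
subS⇒≼ []          []          h = []
subS⇒≼ (true ∷ B)  (true ∷ C)  h = b≤b ∷ subS⇒≼ B C h
subS⇒≼ (false ∷ B) (true ∷ C)  h = f≤t ∷ subS⇒≼ B C h
subS⇒≼ (false ∷ B) (false ∷ C) h = b≤b ∷ subS⇒≼ B C h

≼⇒subS : B ≼ C → subS B C ≡ true
≼⇒subS []                           = refl
≼⇒subS (f≤t ∷ p)                    = ≼⇒subS p
≼⇒subS {B = true ∷ _}  (b≤b ∷ p)    = ≼⇒subS p
≼⇒subS {B = false ∷ _} (b≤b ∷ p)    = ≼⇒subS p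

ssubS⇒≺ : (B C : Subset k) → ssubS B C ≡ true → B ≺ C
ssubS⇒≺ (true ∷ B)  (true ∷ C)  h = keep true (ssubS⇒≺ B C h)
ssubS⇒≺ (false ∷ B) (false ∷ C) h = keep false (ssubS⇒≺ B C h)
ssubS⇒≺ (false ∷ B) (true ∷ C)  h = drop (subS⇒≼ B C (proj₁ (∧-true⁻ h)))

≺⇒ssubS : B ≺ C → ssubS B C ≡ true
≺⇒ssubS (drop p)       = ∧-true (≼⇒subS p) refl
≺⇒ssubS (keep true p)  = ≺⇒ssubS p
≺⇒ssubS (keep false p) = ≺⇒ssubS p

-- Arc lists of arc sets

module _ {V : Set} where

  private variable
    f : V → ℕ

  select : (Fin k → V × V) → Subset k → List (V × V)
  select a []          = []
  select a (true ∷ B)  = a zero ∷ select (a ∘ suc) B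
  select a (false ∷ B) = select (a ∘ suc) B

  ∈-select⁺ : (a : Fin k → V × V) → ∀ i B → i ∈ₛ B → a i ∈ select a B
  ∈-select⁺ a zero    (true ∷ B)  refl = here refl
  ∈-select⁺ a (suc i) (true ∷ B)  h    = there (∈-select⁺ (a ∘ suc) i B h)
  ∈-select⁺ a (suc i) (false ∷ B) h    = ∈-select⁺ (a ∘ suc) i B h

  ∈-select⁻ : (a : Fin k → V × V) → ∀ B {e} → e ∈ select a B → ∃ λ i → i ∈ₛ B × e ≡ a i
  ∈-select⁻ a (true ∷ B) (here refl) = zero , refl , refl
  ∈-select⁻ a (true ∷ B) (there h) with i , p , q ← ∈-select⁻ (a ∘ suc) B h = suc i , p , q
  ∈-select⁻ a (false ∷ B) h with i , p , q ← ∈-select⁻ (a ∘ suc) B h = suc i , p , q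

  select-empty : (a : Fin k → V × V) → ∀ B → isEmptyS B ≡ true → select a B ≡ []
  select-empty a []          h = refl
  select-empty a (false ∷ B) h = select-empty (a ∘ suc) B h

  select-nonempty : (a : Fin k → V × V) → ∀ B → isEmptyS B ≡ false → ∃ λ e → ∃ λ S → select a B ≡ e ∷ S
  select-nonempty a (true ∷ B)  h = a zero , select (a ∘ suc) B , refl
  select-nonempty a (false ∷ B) h = select-nonempty (a ∘ suc) B h

  loopCount≤1 : ∀ f (u v : V) → loopCount f u v ≤ 1
  loopCount≤1 f u v with f u ℕ.≟ f v
  ... | yes p = ℕₚ.≤-reflexive (loopCount-loop {f = f} p)
  ... | no ¬p = ℕₚ.≤-trans (ℕₚ.≤-reflexive (loopCount-nonloop {f = f} ¬p)) z≤n

  -- This bounds the rank by the number of arcs, so the fuel of `muF` and the range searched by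
  -- `rkQ` are large enough.
  nullity-≤ : ∀ f (a : Fin k → V × V) B → nullity f (select a B) ≤ k
  nullity-≤ f a []          = z≤n
  nullity-≤ f a (true ∷ B)  = ℕₚ.+-mono-≤ (loopCount≤1 f _ _) (nullity-≤ _ (a ∘ suc) B)
  nullity-≤ f a (false ∷ B) = ℕₚ.m≤n⇒m≤1+n (nullity-≤ f (a ∘ suc) B)

  nullity-∷-≤ : ∀ f (e : V × V) S → nullity f S ≤ nullity f (e ∷ S)
  nullity-∷-≤ f (u , v) S = subst (nullity f S ≤_) (sym (nullity-last f u v S)) (ℕₚ.m≤m+n _ _)

  nullity-mono : ∀ f (a : Fin k → V × V) {B C} → B ≼ C → nullity f (select a B) ≤ nullity f (select a C)
  nullity-mono f a [] = z≤n
  nullity-mono f a {_} {_ ∷ C} (f≤t ∷ p) =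
    ℕₚ.≤-trans (nullity-mono f (a ∘ suc) p) (nullity-∷-≤ f (a zero) (select (a ∘ suc) C))
  nullity-mono f a {true ∷ _}  (b≤b ∷ p) = ℕₚ.+-monoʳ-≤ (loopCount f _ _) (nullity-mono _ (a ∘ suc) p)
  nullity-mono f a {false ∷ _} (b≤b ∷ p) = nullity-mono f (a ∘ suc) p

  -- Consider the first arc of `C` missing from `B`, after contraction of the common arcs before it.
  -- Its return path connects its ends through later arcs of `C`, so placed last it adds one.
  nullity-strict : ∀ f (a : Fin k → V × V) {B C} → B ≺ C → Cyclic f (select a C) →
                   nullity f (select a B) < nullity f (select a C)
  nullity-strict f a {_} {_ ∷ C} (drop p) c =
    ℕₚ.≤-trans (s≤s (nullity-mono f (a ∘ suc) p)) (ℕₚ.≤-reflexive (sym (begin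
      nullity f (a zero ∷ S)  ≡⟨ nullity-last f _ _ S ⟩
      nullity f S ℕ.+ loopCount (contractAll f S) _ _
        ≡⟨ cong (nullity f S ℕ.+_) (loopCount-loop {f = contractAll f S} (sym (Path-contractAll (Cyclic-return c)))) ⟩
      nullity f S ℕ.+ 1       ≡⟨ ℕₚ.+-comm _ 1 ⟩
      suc (nullity f S)       ∎)))
    where
    open ≡-Reasoning
    S = select (a ∘ suc) C
  nullity-strict f a (keep true p) c =
    ℕₚ.+-monoʳ-< (loopCount f _ _) (nullity-strict _ (a ∘ suc) p (Cyclic-contract c))
  nullity-strict f a (keep false p) c = nullity-strict f (a ∘ suc) p c

  -- In the last case the flow through the contracted arc would be negative on the facet B′
  -- although it is positive inside the face, so it vanishes on a facet omitting only that arc.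
  lower-cover : ∀ f (a : Fin k → V × V) B {e} → Cyclic f (select a B) → e ∈ select a B →
    ∃ λ B′ → B′ ≺ B × Cyclic f (select a B′) × nullity f (select a B) ≡ suc (nullity f (select a B′))
  lower-cover f a (false ∷ B) c i with B′ , p , q , r ← lower-cover f (a ∘ suc) B c i =
    false ∷ B′ , keep false p , q , r
  lower-cover f a (true ∷ B) c i with f (proj₁ (a zero)) ℕ.≟ f (proj₂ (a zero))
  ... | yes eq = false ∷ B , drop ≼-refl , Cyclic-loop eq c , nullity-loop {f = f} eq (select (a ∘ suc) B)
  ... | no ne = contracted (Cyclic-return c)
    where
    u = proj₁ (a zero)
    v = proj₂ (a zero)
    L = select (a ∘ suc)

    Goal : Set
    Goal = ∃ λ B′ → B′ ≺ true ∷ B × Cyclic f (select a B′) ×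
             nullity f (a zero ∷ L B) ≡ suc (nullity f (select a B′))

    cases : ∀ B′ → B′ ≺ B → Cyclic (merge f u v) (L B′) →
      nullity (merge f u v) (L B) ≡ suc (nullity (merge f u v) (L B′)) →
      Dec (Path f (L B′) u v) → Dec (Path f (L B′) v u) → Goal
    -- The contracted arc has a return path in `B′` and is put back.
    cases B′ p d eq _ (yes q) = true ∷ B′ , keep true p , Cyclic-uncontract q d ,
      trans (nullity-nonloop ne (L B)) (trans eq (cong suc (sym (nullity-nonloop ne (L B′)))))
    cases B′ p d eq (no ¬q) (no ¬r) = false ∷ B′ , drop (≺⇒≼ p) , d′ ,
      trans (nullity-nonloop ne (L B)) (trans eq (cong suc (nullity-separated ne d′ ¬q)))
      where d′ = Cyclic-unmerge-¬ ¬q ¬r d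
    cases B′ p d eq (yes q) (no _) = false ∷ B , drop ≼-refl ,
      Cyclic-unmerge q′ (Cyclic-return c) (Cyclic-contract c) ,
      trans (nullity-nonloop ne (L B)) (nullity-joined ne q′)
      where
      L-⊆ : ∀ {e} → e ∈ L B′ → e ∈ L B
      L-⊆ h with j , r , refl ← ∈-select⁻ (a ∘ suc) B′ h =
        ∈-select⁺ (a ∘ suc) j B (subS⁻ {B = B′} {B} (≼⇒subS (≺⇒≼ p)) r)
      q′ : Path f (L B) u v
      q′ = Path-⊆ L-⊆ q

    contracted : Path f (L B) v u → Goal
    contracted (nil eq) = ⊥-elim (ne (sym eq))
    -- The first arc of the return path shows that the contraction is nonempty, as the recursive
    -- call requires.
    contracted (step _ j _)
      with B′ , p , d , eq ← lower-cover (merge f u v) (a ∘ suc) B (Cyclic-contract c) j =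
      cases B′ p d eq (path? f (L B′) u v) (path? f (L B′) v u)

-- Reachability

module _ {k : ℕ} where

  private variable
    R : Rel k
    P : Fin k → Fin k → Set

  iterate-sound : (∀ {x y z} → P x y → P y z → P x z) → (∀ {x y} → R x y ≡ true → P x y) →
                  ∀ i {x y} → iterate i R x y ≡ true → P x y
  iterate-sound tr R⊆P zero h = R⊆P h
  iterate-sound {P = P} {R = R} tr R⊆P (suc i) = iterate-sound tr square⊆P i
    where
    square⊆P : ∀ {x y} → square R x y ≡ true → P x y
    square⊆P {x} {y} h with ∨-true⁻ {R x y} h
    ... | inj₁ p = R⊆P p
    ... | inj₂ p with w , q ← anyFin⁻ _ p with q₁ , q₂ ← ∧-true⁻ {R x w} q = tr (R⊆P q₁) (R⊆P q₂)

  data Chain (R : Rel k) : ℕ → Fin k → Fin k → Set where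
    []  : ∀ {x} → Chain R 0 x x
    _∷_ : ∀ {l x y z} → R x y ≡ true → Chain R l y z → Chain R (suc l) x z

  Chain-square : ∀ {l x y} → Chain R l x y → Chain (square R) ⌈ l /2⌉ x y
  Chain-square [] = []
  Chain-square (p ∷ []) = ∨-trueˡ p ∷ []
  Chain-square {R = R} (_∷_ {x = x} {y = w} p (_∷_ {y = z} q c)) =
    ∨-trueʳ {R x z} (anyFin⁺ (λ v → R x v ∧ R v z) w (∧-true p q)) ∷ Chain-square c

  -- Each squaring halves a chain, rounding up, until at most one step is left; reflexivity settles
  -- the empty chain.
  iterate-complete : (∀ x → R x x ≡ true) → ∀ i {l x y} → l ≤ 2 ℕ.^ i → Chain R l x y → iterate i R x y ≡ true
  iterate-complete rfl zero l≤1 [] = rfl _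
  iterate-complete rfl zero l≤1 (p ∷ []) = p
  iterate-complete rfl zero (s≤s ()) (_ ∷ _ ∷ _)
  iterate-complete {R = R} rfl (suc i) {l} le c =
    iterate-complete (λ x → ∨-trueˡ (rfl x)) i half (Chain-square c)
    where
    half : ⌈ l /2⌉ ≤ 2 ℕ.^ i
    half = ℕₚ.≤-trans (ℕₚ.⌈n/2⌉-mono le) (ℕₚ.≤-reflexive
      (trans (cong (λ j → ⌈ 2 ℕ.^ i ℕ.+ j /2⌉) (ℕₚ.+-identityʳ (2 ℕ.^ i))) (sym (ℕₚ.n≡⌈n+n/2⌉ (2 ℕ.^ i)))))

  iterate-base : (∀ x → R x x ≡ true) → ∀ i {x y} → R x y ≡ true → iterate i R x y ≡ true
  iterate-base rfl i p = iterate-complete rfl i (ℕₚ.m^n>0 2 i) (p ∷ [])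

n≤2^n : ∀ n → n ≤ 2 ℕ.^ n
n≤2^n zero = z≤n
n≤2^n (suc n) = ℕₚ.≤-trans (ℕₚ.+-mono-≤ (ℕₚ.m^n>0 2 n) (n≤2^n n))
  (ℕₚ.≤-reflexive (cong (2 ℕ.^ n ℕ.+_) (sym (ℕₚ.+-identityʳ _))))

lookup-injective : ∀ {X : Set} {xs : List X} → Unique xs → ∀ {i j} → List.lookup xs i ≡ List.lookup xs j → i ≡ j
lookup-injective (_ ∷ _)  {zero}  {zero}  _ = refl
lookup-injective (p ∷ ps) {suc i} {suc j} h = cong suc (lookup-injective ps h)
lookup-injective (p ∷ ps) {zero}  {suc j} h = ⊥-elim (All.lookup p (∈-lookup j) h)
lookup-injective (p ∷ ps) {suc i} {zero}  h = ⊥-elim (All.lookup p (∈-lookup i) (sym h))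

Unique⇒length≤ : {xs : List (Fin k)} → Unique xs → length xs ≤ k
Unique⇒length≤ u = injective⇒≤ (lookup-injective u)

-- Directed walks and totally cyclic arc sets

module _ (D : Digraph) where

  ends : Fin (m D) → Fin (n D) × Fin (n D)
  ends e = tl D e , hd D e

  arcs : Subset (m D) → List (Fin (n D) × Fin (n D))
  arcs = select ends

  Reach : Subset (m D) → Fin (n D) → Fin (n D) → Set
  Reach B = Path toℕ (arcs B)

  TotallyCyclic : Subset (m D) → Set
  TotallyCyclic B = Cyclic toℕ (arcs B)

  Reach-arc : ∀ B {e} → e ∈ₛ B → Reach B (tl D e) (hd D e)
  Reach-arc B {e} p = arc (∈-select⁺ ends e B p)

  data Walk (B : Subset (m D)) : Fin (n D) → Fin (n D) → List (Fin (m D)) → Set where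
    []  : ∀ {x} → Walk B x x []
    _∷_ : ∀ {e y es} → e ∈ₛ B → Walk B (hd D e) y es → Walk B (tl D e) y (e ∷ es)

  -- The end and the tails are all the vertices visited. For a return walk of an arc `e` they are
  -- the tails of the closed cycle, as tested by `distinct`.
  SimpleWalk : Subset (m D) → Fin (n D) → Fin (n D) → Set
  SimpleWalk B x y = ∃ λ es → Walk B x y es × Unique (y ∷ map (tl D) es)

  suffix : ∀ {B x y z es} → Walk B z y es → Unique (y ∷ map (tl D) es) → x ∈ map (tl D) es → SimpleWalk B x y
  suffix (p ∷ w) u (here refl) = _ , p ∷ w , u
  suffix (p ∷ w) ((_ ∷ y≢) ∷ (_ ∷ u)) (there i) = suffix w (y≢ ∷ u) i

  -- Loop erasure: when the new first vertex is already on the simple walk, only the part from that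
  -- vertex on is kept.
  simplify : ∀ {B x y} → Reach B x y → SimpleWalk B x y
  simplify (nil p) with refl ← toℕ-injective p = [] , [] , [] ∷ []
  simplify {B} {x} {y} (step p i q)
    with e , e∈B , refl ← ∈-select⁻ ends B i
    with refl ← toℕ-injective p
    with es , w , u@(y≢ ∷ u′) ← simplify q
    with x Fin.≟ y | _∈?_ Fin._≟_ x (map (tl D) es)
  ... | yes refl | _     = [] , [] , [] ∷ []
  ... | no _     | yes j = suffix w u j
  ... | no x≢y   | no x∉ = e ∷ es , e∈B ∷ w , ((λ r → x≢y (sym r)) ∷ y≢) ∷ (¬Any⇒All¬ _ x∉ ∷ u′)

  reach⇒Reach : ∀ B {x y} → reach D B x y ≡ true → Reach B x y
  reach⇒Reach B = iterate-sound {P = Reach B} Path-trans (λ {x} {y} → base {x} {y}) (n D)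
    where
    base : ∀ {x y} → (x == y) ∨ anyFin (λ e → elem e B ∧ (tl D e == x) ∧ (hd D e == y)) ≡ true → Reach B x y
    base {x} {y} h with ∨-true⁻ {x == y} h
    ... | inj₁ p = nil (cong toℕ (==⁻ p))
    ... | inj₂ p with e , q ← anyFin⁻ _ p
                 with e∈B , r ← ∧-true⁻ {elem e B} q
                 with r₁ , r₂ ← ∧-true⁻ {tl D e == x} r
                 with refl ← ==⁻ r₁
                 with refl ← ==⁻ r₂ = Reach-arc B e∈B

  Reach⇒reach : ∀ B {x y} → Reach B x y → reach D B x y ≡ true
  Reach⇒reach B {x} {y} p with es , w , _ ∷ u ← simplify p =
    iterate-complete (λ x → ∨-trueˡ (==⁺ {i = x} refl)) (n D)
      -- A simple walk has distinct tails, hence at most `n D` arcs, and `n D` squarings cover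
      -- lengths up to `2 ^ n D`.
      (ℕₚ.≤-trans (ℕₚ.≤-trans (ℕₚ.≤-reflexive (sym (length-map (tl D) es))) (Unique⇒length≤ u)) (n≤2^n (n D)))
      (chain w)
    where
    chain : ∀ {x y es} → Walk B x y es → Chain _ (length es) x y
    chain [] = []
    chain (_∷_ {e} e∈B w) = ∨-trueʳ {tl D e == hd D e}
      (anyFin⁺ (λ e′ → elem e′ B ∧ (tl D e′ == tl D e) ∧ (hd D e′ == hd D e)) e
      (∧-true e∈B (∧-true (==⁺ {i = tl D e} refl) (==⁺ {i = hd D e} refl)))) ∷ chain w

  -- An arc traversed against its direction is replaced by its return path.
  weakConn⇒Reach : ∀ B → TotallyCyclic B → ∀ {x y} → weakConn D B x y ≡ true → Reach B x y
  weakConn⇒Reach B c = iterate-sound {P = Reach B} Path-trans (λ {x} {y} → base {x} {y}) (n D)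
    where
    base : ∀ {x y} → (x == y) ∨ anyFin (λ e → elem e B ∧
             (((tl D e == x) ∧ (hd D e == y)) ∨ ((tl D e == y) ∧ (hd D e == x)))) ≡ true → Reach B x y
    base {x} {y} h with ∨-true⁻ {x == y} h
    ... | inj₁ p = nil (cong toℕ (==⁻ p))
    ... | inj₂ p with e , q ← anyFin⁻ _ p
                 with e∈B , r ← ∧-true⁻ {elem e B} q
                 with ∨-true⁻ {(tl D e == x) ∧ (hd D e == y)} r
    ...   | inj₁ s with s₁ , s₂ ← ∧-true⁻ {tl D e == x} s
                   with refl ← ==⁻ s₁ with refl ← ==⁻ s₂ = Reach-arc B e∈B
    ...   | inj₂ s with s₁ , s₂ ← ∧-true⁻ {tl D e == y} s
                   with refl ← ==⁻ s₁ with refl ← ==⁻ s₂ = c (∈-select⁺ ends e B e∈B)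

  weakConn-arc : ∀ B {e} → e ∈ₛ B → weakConn D B (hd D e) (tl D e) ≡ true
  weakConn-arc B {e} e∈B = iterate-base (λ x → ∨-trueˡ (==⁺ {i = x} refl)) (n D)
    (∨-trueʳ {hd D e == tl D e} (anyFin⁺ (λ e′ → elem e′ B ∧
        (((tl D e′ == hd D e) ∧ (hd D e′ == tl D e)) ∨ ((tl D e′ == tl D e) ∧ (hd D e′ == hd D e)))) e
      (∧-true e∈B (∨-trueʳ {(tl D e == hd D e) ∧ (hd D e == tl D e)}
        (∧-true (==⁺ {i = tl D e} refl) (==⁺ {i = hd D e} refl))))))

  -- The condition is applied to the head and tail of one arc, which are weakly connected by that
  -- arc.
  inQ⇒TotallyCyclic : ∀ B → inQ D B ≡ true → TotallyCyclic B
  inQ⇒TotallyCyclic B h i with e , e∈B , refl ← ∈-select⁻ ends B i =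
    reach⇒Reach B (case (∨-true⁻ (allFin?⁻ _ (allFin?⁻ _ h (hd D e)) (tl D e))))
    where
    case : not (inVB D B (hd D e) ∧ inVB D B (tl D e) ∧ weakConn D B (hd D e) (tl D e)) ≡ true
             ⊎ reach D B (hd D e) (tl D e) ≡ true → reach D B (hd D e) (tl D e) ≡ true
    case (inj₂ r) = r
    case (inj₁ r) with () ← trans (sym r) (cong not
      (∧-true (anyFin⁺ (λ e′ → elem e′ B ∧ ((tl D e′ == hd D e) ∨ (hd D e′ == hd D e))) e
                 (∧-true e∈B (∨-trueʳ {tl D e == hd D e} (==⁺ {i = hd D e} refl))))
      (∧-true (anyFin⁺ (λ e′ → elem e′ B ∧ ((tl D e′ == tl D e) ∨ (hd D e′ == tl D e))) e
                 (∧-true e∈B (∨-trueˡ (==⁺ {i = tl D e} refl))))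
              (weakConn-arc B e∈B))))

  TotallyCyclic⇒inQ : ∀ B → TotallyCyclic B → inQ D B ≡ true
  TotallyCyclic⇒inQ B c = allFin?⁺ _ (λ x → allFin?⁺ _ (λ y → case x y))
    where
    case : ∀ x y → not (inVB D B x ∧ inVB D B y ∧ weakConn D B x y) ∨ reach D B x y ≡ true
    case x y with inVB D B x ∧ inVB D B y ∧ weakConn D B x y in eq
    ... | false = refl
    ... | true  = Reach⇒reach B (weakConn⇒Reach B c
                    (proj₂ (∧-true⁻ {inVB D B y} (proj₂ (∧-true⁻ {inVB D B x} eq)))))

  -- Unions of directed cycles

  arcSetOf⁻ : ∀ {j i} (es : Vec (Fin (m D)) j) → i ∈ₛ arcSetOf es → i ∈ toList es
  arcSetOf⁻ {i = i} es h
    with e , e∈ , p ← anyL⁻ (i ==_) (toList es) (trans (sym (lookup∘tabulate _ i)) h)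
    with refl ← ==⁻ p = e∈

  arcSetOf⁺ : ∀ {j i} (es : Vec (Fin (m D)) j) → i ∈ toList es → i ∈ₛ arcSetOf es
  arcSetOf⁺ {i = i} es p = trans (lookup∘tabulate _ i) (anyL⁺ (i ==_) p (==⁺ {i = i} refl))

  -- The linking test of `isDirCycle` with the closing arc `z` kept separate from the first arc, so
  -- that recursion along the sequence is possible.
  Linked : ∀ {j} → Fin (m D) → Vec (Fin (m D)) j → Fin (m D) → Set
  Linked e es z = andL (toList (zipWith (λ e₁ e₂ → hd D e₁ == tl D e₂) (e ∷ es) (es ∷ʳ z))) ≡ true

  -- With `z` equal to `e`, the two paths compose to a return path for any arc of the cycle.
  Linked-Reach : ∀ B {j} e (es : Vec (Fin (m D)) j) z → Linked e es z →
    (∀ {i} → i ∈ toList (e ∷ es) → i ∈ₛ B) →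
    ∀ {i} → i ∈ toList (e ∷ es) → Reach B (tl D e) (tl D i) × Reach B (hd D i) (tl D z)
  Linked-Reach B e [] z h es⊆B (here refl) = nil refl , nil (cong toℕ (==⁻ (proj₁ (∧-true⁻ h))))
  Linked-Reach B e (e′ ∷ es) z h es⊆B i∈ with h₁ , h₂ ← ∧-true⁻ {hd D e == tl D e′} h = go i∈
    where
    hop : Reach B (hd D e) (tl D e′)
    hop = nil (cong toℕ (==⁻ h₁))

    rest : ∀ {i} → i ∈ toList (e′ ∷ es) → Reach B (tl D e′) (tl D i) × Reach B (hd D i) (tl D z)
    rest = Linked-Reach B e′ es z h₂ (es⊆B ∘ there)

    go : ∀ {i} → i ∈ toList (e ∷ e′ ∷ es) → Reach B (tl D e) (tl D i) × Reach B (hd D i) (tl D z)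
    go (here refl) = nil refl ,
      Path-trans hop (Path-trans (Reach-arc B (es⊆B (there (here refl)))) (proj₂ (rest (here refl))))
    go (there i) = Path-trans (Reach-arc B (es⊆B (here refl))) (Path-trans hop (proj₁ (rest i))) , proj₂ (rest i)

  isDirCycle-return : ∀ B {j} (es : Vec (Fin (m D)) (suc j)) → isDirCycle D es ≡ true →
    (∀ {i} → i ∈ toList es → i ∈ₛ B) → ∀ {i} → i ∈ toList es → Reach B (hd D i) (tl D i)
  isDirCycle-return B (e ∷ es) h es⊆B i∈
    with p , q ← Linked-Reach B e es e (proj₁ (∧-true⁻ h)) es⊆B i∈ = Path-trans q p

  IsCycleSet : Subset (m D) → Set
  IsCycleSet C = ∃ λ j → ∃ λ (es : Vec (Fin (m D)) (suc j)) → isDirCycle D es ≡ true × C ≡ arcSetOf es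

  ∈-cycleArcSets⁻ : ∀ {C} → C ∈ cycleArcSets D → IsCycleSet C
  ∈-cycleArcSets⁻ h with Any.satisfied (∈-concatMap⁻ _ {xs = upTo (m D)} h)
  ... | j , h′ with es , es∈ , refl ← ∈-map⁻ arcSetOf h′ =
    j , es , proj₂ (∈-filter⁻ (λ es → Bool._≟_ (isDirCycle D es) true) {xs = allVecs (allFin (m D)) (suc j)} es∈) , refl

  ∈-allVecs : ∀ {j} (es : Vec (Fin (m D)) j) → es ∈ allVecs (allFin (m D)) j
  ∈-allVecs [] = here refl
  ∈-allVecs (e ∷ es) = ∈-concatMap⁺ _ (lose (∈-allFin e) (∈-map⁺ (e ∷_) (∈-allVecs es)))

  ∈-cycleArcSets⁺ : ∀ {j} (es : Vec (Fin (m D)) (suc j)) → j < m D → isDirCycle D es ≡ true →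
                    arcSetOf es ∈ cycleArcSets D
  ∈-cycleArcSets⁺ {j} es j<m h = ∈-concatMap⁺ _ (lose (∈-upTo⁺ j<m)
    (∈-map⁺ arcSetOf (∈-filter⁺ (λ es → Bool._≟_ (isDirCycle D es) true) (∈-allVecs es) h)))

  Walk-Linked : ∀ {B} e {z x y es} → Walk B x y es → hd D e ≡ x → tl D z ≡ y → Linked e (fromList es) z
  Walk-Linked e {z} [] p q = ∧-true (==⁺ {j = tl D z} (trans p (sym q))) refl
  Walk-Linked e (_∷_ {e′} _ w) p q = ∧-true (==⁺ {j = tl D e′} p) (Walk-Linked e′ w refl q)

  Walk-⊆ : ∀ {B x y es} → Walk B x y es → ∀ {i} → i ∈ es → i ∈ₛ B
  Walk-⊆ (p ∷ w) (here refl) = p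
  Walk-⊆ (p ∷ w) (there i) = Walk-⊆ w i

  distinct⁺ : {xs : List (Fin k)} → Unique xs → distinct xs ≡ true
  distinct⁺ [] = refl
  distinct⁺ {xs = x ∷ xs} (p ∷ ps) =
    ∧-true (Boolₚ.¬-not λ h → case (anyL⁻ (x ==_) xs (Boolₚ.not-injective h))) (distinct⁺ ps)
    where
    case : ¬ ∃ λ y → y ∈ xs × (x == y) ≡ true
    case (y , y∈ , q) = All.lookup p y∈ (==⁻ q)

  -- A simple return walk of `e` is closed up by `e` itself.
  arc-on-cycle : ∀ B → TotallyCyclic B → ∀ {e} → e ∈ₛ B →
    ∃ λ C → C ∈ cycleArcSets D × e ∈ₛ C × (∀ {i} → i ∈ₛ C → i ∈ₛ B)
  arc-on-cycle B c {e} e∈B with es , w , u ← simplify {B} (c (∈-select⁺ ends e B e∈B)) =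
    arcSetOf cyc , ∈-cycleArcSets⁺ cyc len (∧-true (Walk-Linked e w refl refl) dist) ,
    arcSetOf⁺ cyc (here refl) , λ {i} i∈ → inB (subst (i ∈_) list≡ (arcSetOf⁻ cyc i∈))
    where
    cyc = e ∷ fromList es

    list≡ : toList cyc ≡ e ∷ es
    list≡ = cong (e ∷_) (toList∘fromList es)

    dist : distinct (toList (Vec.map (tl D) cyc)) ≡ true
    dist = trans (cong distinct (trans (toList-map (tl D) cyc) (cong (map (tl D)) list≡))) (distinct⁺ u)

    len : length es < m D
    -- Distinct tails force distinct arcs, so the cycle has at most `m D` arcs and is in the
    -- enumeration.
    len = Unique⇒length≤ (Unique.map⁻ {f = tl D} {xs = e ∷ es} u)

    inB : ∀ {i} → i ∈ e ∷ es → i ∈ₛ B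
    inB (here refl) = e∈B
    inB (there i) = Walk-⊆ w i

  ∈-unionAll⁻ : ∀ F {i : Fin k} → i ∈ₛ unionAll F → ∃ λ C → C ∈ F × i ∈ₛ C
  ∈-unionAll⁻ [] {i} h with () ← trans (sym h) (lookup-replicate i false)
  ∈-unionAll⁻ (C ∷ F) {i} h with ∨-true⁻ {elem i C} (trans (sym (lookup-zipWith _∨_ i C (unionAll F))) h)
  ... | inj₁ p = C , here refl , p
  ... | inj₂ p with C′ , C′∈ , q ← ∈-unionAll⁻ F p = C′ , there C′∈ , q

  ∈-unionAll⁺ : ∀ {F C} {i : Fin k} → C ∈ F → i ∈ₛ C → i ∈ₛ unionAll F
  ∈-unionAll⁺ {F = C ∷ F} {i = i} (here refl) h = trans (lookup-zipWith _∨_ i C (unionAll F)) (∨-trueˡ h)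
  ∈-unionAll⁺ {F = C′ ∷ F} {i = i} (there p) h =
    trans (lookup-zipWith _∨_ i C′ (unionAll F)) (∨-trueʳ {elem i C′} (∈-unionAll⁺ p h))

  sublists-⊆ : ∀ {X : Set} (xs : List X) {ys} → ys ∈ sublists xs → ∀ {y} → y ∈ ys → y ∈ xs
  sublists-⊆ [] (here refl) ()
  sublists-⊆ (x ∷ xs) h y∈ with ∈-++⁻ (sublists xs) h
  ... | inj₁ p = there (sublists-⊆ xs p y∈)
  ... | inj₂ p with zs , zs∈ , refl ← ∈-map⁻ (x ∷_) p with y∈
  ...   | here refl = here refl
  ...   | there q = there (sublists-⊆ xs zs∈ q)

  filter∈sublists : ∀ {X : Set} (p : X → Bool) xs → filter (λ x → Bool._≟_ (p x) true) xs ∈ sublists xs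
  filter∈sublists p [] = here refl
  filter∈sublists p (x ∷ xs) with p x
  ... | true  = ∈-++⁺ʳ (sublists xs) (∈-map⁺ (x ∷_) (filter∈sublists p xs))
  ... | false = ∈-++⁺ˡ (filter∈sublists p xs)

  -- Each arc lies on a cycle of the family, and the rest of that cycle is its return path inside
  -- `C`.
  inU⇒TotallyCyclic : ∀ C → inU D C ≡ true → TotallyCyclic C
  inU⇒TotallyCyclic C h i
    with F , F∈ , p ← anyL⁻ _ (sublists (cycleArcSets D)) h
    with refl ← eqS⁻ (unionAll F) C p
    with e , e∈ , refl ← ∈-select⁻ ends C i
    with C′ , C′∈ , e∈C′ ← ∈-unionAll⁻ F e∈
    with j , es , cyc , refl ← ∈-cycleArcSets⁻ (sublists-⊆ _ F∈ C′∈) =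
    isDirCycle-return C es cyc (λ i∈ → ∈-unionAll⁺ C′∈ (arcSetOf⁺ es i∈)) (arcSetOf⁻ es e∈C′)

  -- The family consists of all directed cycles contained in `C`; they cover it by `arc-on-cycle`.
  TotallyCyclic⇒inU : ∀ C → TotallyCyclic C → inU D C ≡ true
  TotallyCyclic⇒inU C c = anyL⁺ _ (filter∈sublists (λ C′ → subS C′ C) (cycleArcSets D))
    (subst (λ C′ → eqS (unionAll F) C′ ≡ true) (⊆-antisym {B = unionAll F} {C} to from) (eqS-refl (unionAll F)))
    where
    sub? = λ C′ → Bool._≟_ (subS C′ C) true
    F = filter sub? (cycleArcSets D)

    to : ∀ {i} → i ∈ₛ unionAll F → i ∈ₛ C
    to i∈ with C′ , C′∈ , p ← ∈-unionAll⁻ F i∈ =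
      subS⁻ {B = C′} {C} (proj₂ (∈-filter⁻ sub? {xs = cycleArcSets D} C′∈)) p

    from : ∀ {i} → i ∈ₛ C → i ∈ₛ unionAll F
    from i∈ with C′ , C′∈ , p , C′⊆C ← arc-on-cycle C c i∈ =
      ∈-unionAll⁺ (∈-filter⁺ sub? C′∈ (subS⁺ {B = C′} {C} C′⊆C)) p

  inU≡inQ : ∀ C → inU D C ≡ inQ D C
  inU≡inQ C = true⇔⇒≡ (TotallyCyclic⇒inQ C ∘ inU⇒TotallyCyclic C) (TotallyCyclic⇒inU C ∘ inQ⇒TotallyCyclic C)

  -- Rank

  rank : Subset (m D) → ℕ
  rank B = nullity toℕ (arcs B)

  -- Each strict inclusion in the chain raises the nullity, by `nullity-strict`.
  chainQ⇒≤rank : ∀ r B → chainQ D r B ≡ true → r ≤ rank B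
  chainQ⇒≤rank zero B h = z≤n
  chainQ⇒≤rank (suc r) B h
    with p , q ← ∧-true⁻ {inQ D B} h
    with B′ , _ , s ← anyL⁻ _ (allSubsets (m D)) q
    with s₁ , s₂ ← ∧-true⁻ {inQ D B′} s
    with t₁ , t₂ ← ∧-true⁻ {ssubS B′ B} s₂ =
    ℕₚ.≤-trans (s≤s (chainQ⇒≤rank r B′ t₂))
      (nullity-strict toℕ ends (ssubS⇒≺ B′ B t₁) (inQ⇒TotallyCyclic B p))

  -- Descending through lower covers loses exactly one from the rank each time and ends at the empty
  -- set.
  chainQ-rank : ∀ r B → TotallyCyclic B → rank B ≡ r → chainQ D r B ≡ true
  chainQ-rank r B c eq with isEmptyS B in empty
  chainQ-rank zero B c eq | true = empty
  chainQ-rank (suc r) B c eq | true with () ← trans (sym eq) (cong (nullity toℕ) (select-empty ends B empty))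
  chainQ-rank r B c eq | false
    with e , S , sel ← select-nonempty ends B empty
    with B′ , p , c′ , eq′ ← lower-cover toℕ ends B {e} c (subst (e ∈_) (sym sel) (here refl))
    with r
  ... | zero with () ← trans (sym eq) eq′
  ... | suc r = ∧-true (TotallyCyclic⇒inQ B c) (anyL⁺ _ (∈-allSubsets B′)
      (∧-true (TotallyCyclic⇒inQ B′ c′) (∧-true (≺⇒ssubS p)
        (chainQ-rank r B′ c′ (ℕₚ.suc-injective (trans (sym eq′) eq))))))

  foldr-max : (p : ℕ → Bool) → ∀ M → (∀ r → p r ≡ true → r ≤ M) → ∀ rs →
    let top = foldr (λ r acc → if p r then r ⊔ acc else acc) 0 rs in top ≤ M × (M ∈ rs → p M ≡ true → top ≡ M)
  foldr-max p M bound [] = z≤n , λ ()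
  foldr-max p M bound (r ∷ rs) with foldr-max p M bound rs | p r in eq
  ... | le , at | false = le , λ where
    (here refl) pM → case trans (sym eq) pM of λ ()
    (there i) pM → at i pM
  ... | le , at | true = ℕₚ.⊔-lub (bound r eq) le , λ where
    (here refl) _ → ℕₚ.m≥n⇒m⊔n≡m le
    (there i) pM → trans (cong (r ⊔_) (at i pM)) (ℕₚ.m≤n⇒m⊔n≡n (bound r eq))

  rkQ≡rank : ∀ B → TotallyCyclic B → rkQ D B ≡ rank B
  rkQ≡rank B c = proj₂ (foldr-max (λ r → chainQ D r B) (rank B) (λ r → chainQ⇒≤rank r B) (upTo (suc (m D))))
    (∈-upTo⁺ (s≤s (nullity-≤ toℕ ends B))) (chainQ-rank (rank B) B c refl)

-- Möbius function

sumL-++ : ∀ xs ys → sumL (xs ++ ys) ≡ sumL xs + sumL ys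
sumL-++ [] ys = sym (ℤₚ.+-identityˡ _)
sumL-++ (x ∷ xs) ys = trans (cong (λ k → x + k) (sumL-++ xs ys)) (sym (ℤₚ.+-assoc x _ _))

-- Conditions become zero terms, so that sums over different families of subsets can be compared
-- term by term.
sumL-filter : ∀ {X : Set} (p : X → Bool) (g : X → ℤ) xs →
  sumL (map g (filter (λ x → Bool._≟_ (p x) true) xs)) ≡ sumL (map (λ x → if p x then g x else + 0) xs)
sumL-filter p g [] = refl
sumL-filter p g (x ∷ xs) with p x
... | true  = cong (λ k → g x + k) (sumL-filter p g xs)
... | false = trans (sumL-filter p g xs) (sym (ℤₚ.+-identityˡ _))

sumAll : ∀ k → (Subset k → ℤ) → ℤ
sumAll k g = sumL (map g (allSubsets k))

sumAll-suc : (g : Subset (suc k) → ℤ) →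
  sumAll (suc k) g ≡ sumAll k (λ B → g (false ∷ B)) + sumAll k (λ B → g (true ∷ B))
sumAll-suc {k} g = begin
  sumL (map g (map (false ∷_) As ++ map (true ∷_) As))              ≡⟨ cong sumL (map-++ g (map (false ∷_) As) _) ⟩
  sumL (map g (map (false ∷_) As) ++ map g (map (true ∷_) As))      ≡⟨ sumL-++ (map g (map (false ∷_) As)) _ ⟩
  sumL (map g (map (false ∷_) As)) + sumL (map g (map (true ∷_) As))
    ≡⟨ cong₂ _+_ (cong sumL (map-∘ As)) (cong sumL (map-∘ As)) ⟨
  sumAll k (λ B → g (false ∷ B)) + sumAll k (λ B → g (true ∷ B))    ∎
  where
  open ≡-Reasoning
  As = allSubsets k

sumAll-cong : {g h : Subset k → ℤ} → (∀ B → g B ≡ h B) → sumAll k g ≡ sumAll k h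
sumAll-cong eq = cong sumL (map-cong eq (allSubsets _))

sumAll-0 : ∀ k → sumAll k (λ _ → + 0) ≡ + 0
sumAll-0 zero = refl
sumAll-0 (suc k) = trans (sumAll-suc {k} (λ _ → + 0)) (cong₂ _+_ (sumAll-0 k) (sumAll-0 k))

sumAll-+ : (g h : Subset k → ℤ) → sumAll k (λ B → g B + h B) ≡ sumAll k g + sumAll k h
sumAll-+ {zero} g h = trans (ℤₚ.+-identityʳ _) (sym (cong₂ _+_ (ℤₚ.+-identityʳ (g [])) (ℤₚ.+-identityʳ (h []))))
sumAll-+ {suc k} g h = begin
  sumAll (suc k) (λ B → g B + h B)                                       ≡⟨ sumAll-suc (λ B → g B + h B) ⟩
  sumAll k (λ B → g₀ B + h₀ B) + sumAll k (λ B → g₁ B + h₁ B)            ≡⟨ cong₂ _+_ (sumAll-+ g₀ h₀) (sumAll-+ g₁ h₁) ⟩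
  (sumAll k g₀ + sumAll k h₀) + (sumAll k g₁ + sumAll k h₁)              ≡⟨ +-interchange (sumAll k g₀) _ _ _ ⟩
  (sumAll k g₀ + sumAll k g₁) + (sumAll k h₀ + sumAll k h₁)              ≡⟨ cong₂ _+_ (sumAll-suc g) (sumAll-suc h) ⟨
  sumAll (suc k) g + sumAll (suc k) h                                    ∎
  where
  open ≡-Reasoning
  g₀ = λ B → g (false ∷ B)
  g₁ = λ B → g (true ∷ B)
  h₀ = λ B → h (false ∷ B)
  h₁ = λ B → h (true ∷ B)

sumAll-single : (g : Subset k → ℤ) → ∀ C → sumAll k (λ B → if eqS B C then g B else + 0) ≡ g C
sumAll-single g [] = ℤₚ.+-identityʳ _
sumAll-single {suc k} g (true ∷ C) = trans (sumAll-suc (λ B → if eqS B (true ∷ C) then g B else + 0))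
  (trans (cong₂ _+_ (sumAll-0 k) (sumAll-single (λ B → g (true ∷ B)) C)) (ℤₚ.+-identityˡ _))
sumAll-single {suc k} g (false ∷ C) = trans (sumAll-suc (λ B → if eqS B (false ∷ C) then g B else + 0))
  (trans (cong₂ _+_ (sumAll-single (λ B → g (false ∷ B)) C) (sumAll-0 k)) (ℤₚ.+-identityʳ _))

sumSub≡sumAll : ∀ {V : Set} (a : Fin k → V × V) w C →
  sumSub w (select a C) ≡ sumAll k (λ B → if subS B C then w (select a B) else + 0)
sumSub≡sumAll a w [] = sym (ℤₚ.+-identityʳ _)
sumSub≡sumAll {suc k} a w (true ∷ C) = trans
  (cong₂ _+_ (sumSub≡sumAll (a ∘ suc) w C) (sumSub≡sumAll (a ∘ suc) (λ S → w (a zero ∷ S)) C))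
  (sym (sumAll-suc (λ B → if subS B (true ∷ C) then w (select a B) else + 0)))
sumSub≡sumAll {suc k} a w (false ∷ C) = trans
  (trans (sumSub≡sumAll (a ∘ suc) w C) (sym (ℤₚ.+-identityʳ _)))
  (trans (cong (λ k → sumAll _ (λ B → if subS B C then w (select (a ∘ suc) B) else + 0) + k) (sym (sumAll-0 k)))
  (sym (sumAll-suc (λ B → if subS B (false ∷ C) then w (select a B) else + 0))))

sumAll-subS : (g : Subset k → ℤ) → ∀ C →
  sumAll k (λ B → if subS B C then g B else + 0) ≡ sumAll k (λ B → if ssubS B C then g B else + 0) + g C
sumAll-subS g C = begin
  sumAll _ (λ B → if subS B C then g B else + 0)
    ≡⟨ sumAll-cong split ⟩
  sumAll _ (λ B → (if ssubS B C then g B else + 0) + (if eqS B C then g B else + 0))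
    ≡⟨ sumAll-+ (λ B → if ssubS B C then g B else + 0) (λ B → if eqS B C then g B else + 0) ⟩
  sumAll _ (λ B → if ssubS B C then g B else + 0) + sumAll _ (λ B → if eqS B C then g B else + 0)
    ≡⟨ cong (λ k → sumAll _ (λ B → if ssubS B C then g B else + 0) + k) (sumAll-single g C) ⟩
  sumAll _ (λ B → if ssubS B C then g B else + 0) + g C ∎
  where
  open ≡-Reasoning
  split : ∀ B → (if subS B C then g B else + 0) ≡ (if ssubS B C then g B else + 0) + (if eqS B C then g B else + 0)
  split B with subS B C in s | eqS B C in e
  ... | true  | true  = sym (ℤₚ.+-identityˡ _)
  ... | true  | false = sym (ℤₚ.+-identityʳ _)
  ... | false | false = refl
  ... | false | true with refl ← eqS⁻ B C e with () ← trans (sym s) (subS⁺ {B = B} {B} id)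

-- Evaluation of the Möbius function

module _ (D : Digraph) where

  -- The weights solve the Möbius recursion: their sum over the subsets of a nonempty totally cyclic
  -- `C` is `χ`, which vanishes.
  muF≡ : ∀ fuel C → TotallyCyclic D C → rank D C < fuel → muF D fuel C ≡ signPow (rank D C)
  muF≡ (suc fuel) C c (s≤s le) with isEmptyS C in empty
  ... | true = cong (signPow ∘ nullity toℕ) (sym (select-empty (ends D) C empty))
  ... | false with e , S , sel ← select-nonempty (ends D) C empty = begin
    - sumL (map (muF D fuel) (filter (λ B → Bool._≟_ (inU D B ∧ ssubS B C) true) (allSubsets (m D))))
      ≡⟨ cong -_ (sumL-filter (λ B → inU D B ∧ ssubS B C) (muF D fuel) (allSubsets (m D))) ⟩
    - sumAll (m D) (λ B → if inU D B ∧ ssubS B C then muF D fuel B else + 0)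
      ≡⟨ cong -_ (sumAll-cong below) ⟩
    - sumAll (m D) (λ B → if ssubS B C then w B else + 0)
      ≡⟨ sym (Group.inverseʳ-unique (AbelianGroup.group ℤₚ.+-0-abelianGroup) _ _ total) ⟩
    w C ≡⟨ weight-cyclic c ⟩
    signPow (rank D C) ∎
    where
    open ≡-Reasoning
    w : Subset (m D) → ℤ
    w B = weight toℕ (arcs D B)

    total : sumAll (m D) (λ B → if ssubS B C then w B else + 0) + w C ≡ + 0
    total = begin
      sumAll (m D) (λ B → if ssubS B C then w B else + 0) + w C  ≡⟨ sumAll-subS w C ⟨
      sumAll (m D) (λ B → if subS B C then w B else + 0)         ≡⟨ sumSub≡sumAll (ends D) (weight toℕ) C ⟨
      χ toℕ (arcs D C)                                           ≡⟨ cong (χ toℕ) sel ⟩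
      χ toℕ (e ∷ S)                                              ≡⟨ χ-Cyclic (subst (Cyclic toℕ) sel c) ⟩
      + 0                                                        ∎

    -- Proper subsets in 𝒰 have smaller rank, so the remaining fuel suffices; subsets outside 𝒰 are
    -- not totally cyclic and have weight 0.
    below : ∀ B → (if inU D B ∧ ssubS B C then muF D fuel B else + 0) ≡ (if ssubS B C then w B else + 0)
    below B with inU D B in u | ssubS B C in s
    ... | true | true = trans
      (muF≡ fuel B (inU⇒TotallyCyclic D B u) (ℕₚ.<-≤-trans (nullity-strict toℕ (ends D) (ssubS⇒≺ B C s) c) le))
      (sym (weight-cyclic (inU⇒TotallyCyclic D B u)))
    ... | true | false = refl
    ... | false | false = refl
    ... | false | true = sym (weight-¬cyclic (λ d → case trans (sym u) (TotallyCyclic⇒inU D B d) of λ ()))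

  muU≡ : ∀ C → inQ D C ≡ true → muU D C ≡ signPow (rkQ D C)
  muU≡ C h = trans (muF≡ (suc (m D)) C c (s≤s (nullity-≤ toℕ (ends D) C))) (cong signPow (sym (rkQ≡rank D C c)))
    where c = inQ⇒TotallyCyclic D C h

theorem3p4 : (D : Digraph) → (k : ℕ) → psiNLCoeff D k ≡ rhsCoeff D k
theorem3p4 D k = begin
  psiNLCoeff D k
    ≡⟨ sumL-filter (λ C → inU D C ∧ ⌊ rkContr D C ℕ.≟ k ⌋) (muU D) (allSubsets (m D)) ⟩
  sumAll (m D) (λ C → if inU D C ∧ ⌊ rkContr D C ℕ.≟ k ⌋ then muU D C else + 0)
    ≡⟨ sumAll-cong term ⟩
  sumAll (m D) (λ C → if inQ D C ∧ ⌊ rkContr D C ℕ.≟ k ⌋ then signPow (rkQ D C) else + 0)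
    ≡⟨ sumL-filter (λ C → inQ D C ∧ ⌊ rkContr D C ℕ.≟ k ⌋) (signPow ∘ rkQ D) (allSubsets (m D)) ⟨
  rhsCoeff D k ∎
  where
  open ≡-Reasoning
  -- Both sides use the same exponent `rkContr D C`, so only membership and signs have to be
  -- compared.
  term : ∀ C → (if inU D C ∧ ⌊ rkContr D C ℕ.≟ k ⌋ then muU D C else + 0)
             ≡ (if inQ D C ∧ ⌊ rkContr D C ℕ.≟ k ⌋ then signPow (rkQ D C) else + 0)
  term C rewrite inU≡inQ D C with inQ D C in q
  ... | false = refl
  ... | true  = cong (λ z → if ⌊ rkContr D C ℕ.≟ k ⌋ then z else + 0) (muU≡ D C q)
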